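{- Let $G$ be a connected locally finite graph. Every connected subgraph $H\subseteq G$ with $E(H)\subseteq E_{\mathrm{tl}}(G)$ satisfies $$\mathrm{DN}_{\mathrm{LLY}}(H)\le \mathrm{DN}_{\mathrm{LLY}}(G).$$
   Context: Graphs are simple and undirected, possibly infinite. Let $d(\cdot,\cdot)$ be the combinatorial distance of the graph under consideration (for $H$, the distance in $H$). For a positive edge weight $w:E\to(0,\infty)$ put $d_x^w:=\sum_{y\sim x}w_{xy}$. For $\alpha\in[0,1]$ let $\mu_x^{\alpha,w}$ be the probability measure with $\mu_x^{\alpha,w}(x)=\alpha$, $\mu_x^{\alpha,w}(z)=(1-\alpha)w_{xz}/d_x^w$ for $z\sim x$, and $0$ otherwise. Let $W_1$ be the $1$-Wasserstein distance with respect to $d$. For $x\sim y$ let $\kappa_\alpha^w(x,y):=1-W_1(\mu_x^{\alpha,w},\mu_y^{\alpha,w})$ and define the weighted Lin--Lu--Yau curvature $\kappa_{\mathrm{LLY}}^w(x,y):=\lim_{\alpha\to1^- }\kappa_\alpha^w(x,y)/(1-\alpha)$. For connected locally finite $G$ with $E\neq\varnothing$: $\mathrm{Dist}(w):=\sup_{e\in E}w_e/\inf_{e\in E}w_e$, with value $+\infty$ if the supremum is infinite or the infimum is $0$; a positive weight $w$ is admissible if $\kappa_{\mathrm{LLY}}^w(e)\ge0$ for every $e\in E$; and $\mathrm{DN}_{\mathrm{LLY}}(G):=\inf\{\mathrm{Dist}(w): w \text{ admissible}\}$, with value $+\infty$ if no admissible weight has finite distortion. By convention $\mathrm{DN}_{\mathrm{LLY}}(K_1)=1$.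 $E_{\mathrm{tl}}(G)$ is the set of tree-like edges of $G$, i.e. edges lying on no cycle of $G$ of length $3$, $4$ or $5$. -}

module Defs where

open import Level using (0ℓ)
open import Axiom.ExcludedMiddle using (ExcludedMiddle)
open import Algebra.Bundles using (CommutativeRing)
import Algebra.Definitions.RawMonoid as RawMonoidOps
open import Data.Bool.Base using (if_then_else_)
open import Data.Fin.Base using (Fin; toℕ)
open import Data.List.Base using (List; foldr)
open import Data.List.Membership.Propositional using (_∈_; _∉_)
open import Data.List.Relation.Unary.Unique.Propositional using (Unique)
open import Data.Nat.Base as ℕ using (ℕ; zero; suc; NonZero)
open import Data.Nat.DivMod using (_mod_)
open import Data.Product.Base using (Σ-syntax; ∃; ∃-syntax; _×_; _,_; proj₁; uncurry)
open import Data.Sum.Base using (_⊎_)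
open import Function.Bundles using (_⇔_)
open import Function.Definitions using (Injective)
open import Relation.Binary.Core using (Rel)
open import Relation.Binary.PropositionalEquality.Core using (_≡_)
open import Relation.Binary.Structures using (IsTotalOrder)
import Relation.Binary.Construct.Add.Supremum.NonStrict as AddSupremum
open import Relation.Nullary.Construct.Add.Supremum using (_⁺; ⊤⁺; [_])
open import Relation.Nullary.Decidable.Core using (Dec; yes; no; does)
open import Relation.Nullary.Negation.Core using (¬_)

------------------------------------------------------------------------
-- The real numbers

-- The standard library has no real numbers. They enter as an arbitrary
-- Dedekind-complete ordered field, a structure that classically exists and
-- is unique up to unique isomorphism. Equality is a setoid equality, so that
-- Dedekind cuts (as maps ℚ → Bool) are a model at this universe level.
-- The value of 0# ⁻¹ is unspecified and never relevant below.

record CompleteOrderedField : Set₁ where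
  infix 4 _≤_ _<_
  infix 8 _⁻¹
  field
    commutativeRing : CommutativeRing 0ℓ 0ℓ

  open CommutativeRing commutativeRing public

  field
    1≉0          : ¬ (1# ≈ 0#)
    _⁻¹          : Carrier → Carrier
    inverseʳ     : ∀ x → ¬ (x ≈ 0#) → x * x ⁻¹ ≈ 1#
    _≤_          : Rel Carrier 0ℓ
    isTotalOrder : IsTotalOrder _≈_ _≤_
    +-monoʳ-≤    : ∀ z {x y} → x ≤ y → z + x ≤ z + y
    *-nonNeg     : ∀ {x y} → 0# ≤ x → 0# ≤ y → 0# ≤ x * y

  _<_ : Rel Carrier 0ℓ
  x < y = x ≤ y × ¬ (x ≈ y)

  UpperBound : (Carrier → Set) → Carrier → Set
  UpperBound P b = ∀ x → P x → x ≤ b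

  IsSup : (Carrier → Set) → Carrier → Set
  IsSup P s = UpperBound P s × (∀ b → UpperBound P b → s ≤ b)

  field
    complete : (P : Carrier → Set) → ∃ P → ∃ (UpperBound P) → ∃ (IsSup P)

------------------------------------------------------------------------
-- Graphs

-- A simple undirected graph whose vertex set is a subset of the ambient set U.
-- Taking all of U as the vertex set gives an arbitrary graph, and two graphs
-- on the same U can be compared as subgraphs.

record Graph (U : Set) : Set₁ where
  field
    V         : U → Set
    _∼_       : U → U → Set
    ∼-sym     : ∀ {x y} → x ∼ y → y ∼ x
    ∼-irrefl  : ∀ {x} → ¬ (x ∼ x)
    ∼-vertexˡ : ∀ {x y} → x ∼ y → V x

module _ {U : Set} where

  record _⊆ᴳ_ (H G : Graph U) : Set where
    private
      module H = Graph H
      module G = Graph G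
    field
      V-⊆ : ∀ {x} → H.V x → G.V x
      ∼-⊆ : ∀ {x y} → x H.∼ y → x G.∼ y

  module _ (G : Graph U) where
    open Graph G

    data Walk : U → U → ℕ → Set where
      nil  : ∀ {x} → V x → Walk x x zero
      cons : ∀ {x y z n} → x ∼ y → Walk y z n → Walk x z (suc n)

    record Connected : Set where
      field
        nonempty : ∃ V
        joined   : ∀ {x y} → V x → V y → ∃ (Walk x y)

    LocallyFinite : Set
    LocallyFinite = ∀ x → V x → Σ[ l ∈ List U ] (∀ y → (y ∈ l ⇔ x ∼ y))

    HasEdge : Set
    HasEdge = ∃[ x ] ∃[ y ] x ∼ y

    -- Meaningful for n ≥ 3.
    record Cycle (n : ℕ) .{{_ : NonZero n}} : Set where
      next : Fin n → Fin n
      next i = suc (toℕ i) mod n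
      field
        vertex    : Fin n → U
        injective : Injective _≡_ _≡_ vertex
        adjacent  : ∀ i → vertex i ∼ vertex (next i)

    LiesOnCycle : (n : ℕ) .{{_ : NonZero n}} → U → U → Set
    LiesOnCycle n x y = Σ[ c ∈ Cycle n ] Σ[ i ∈ Fin n ]
      let open Cycle c in
        (vertex i ≡ x × vertex (next i) ≡ y)
      ⊎ (vertex i ≡ y × vertex (next i) ≡ x)

    record TreeLike (x y : U) : Set where
      field
        edge : x ∼ y
        no-3 : ¬ LiesOnCycle 3 x y
        no-4 : ¬ LiesOnCycle 4 x y
        no-5 : ¬ LiesOnCycle 5 x y

least : {P : ℕ → Set} → (∀ n → Dec (P n)) → (bound : ℕ) → ℕ
least P? zero    = zero
least P? (suc b) = if does (P? zero) then zero else suc (least (λ n → P? (suc n)) b)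

------------------------------------------------------------------------
-- Classical analysis

-- Excluded middle turns suprema, infima, distances and finite sums into total
-- functions; each gets an arbitrary default value where it is not defined.

module Curvature (em : ExcludedMiddle 0ℓ) (ℛ : CompleteOrderedField) where

  open CompleteOrderedField ℛ renaming (Carrier to ℝ)
  open RawMonoidOps +-rawMonoid using () renaming (_×_ to _·_)
  open AddSupremum _≤_ public using (_≤⁺_)

  sup : (ℝ → Set) → ℝ
  sup P with em {∃ P × ∃ (UpperBound P)}
  ... | yes (inhabited , bounded) = proj₁ (complete P inhabited bounded)
  ... | no _                      = 0#

  inf : (ℝ → Set) → ℝ
  inf P = - sup (λ r → ∃[ s ] P s × r ≈ - s)

  -- Used only for sets of extended reals that are bounded below.
  inf⁺ : (ℝ ⁺ → Set) → ℝ ⁺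
  inf⁺ P with em {∃[ r ] P [ r ]}
  ... | yes _ = [ inf (λ r → P [ r ]) ]
  ... | no _  = ⊤⁺

  module _ {A : Set} where

    sumOver : List A → (A → ℝ) → ℝ
    sumOver l f = foldr (λ a s → f a + s) 0# l

    FinitelySupported : (A → ℝ) → Set
    FinitelySupported f = Σ[ l ∈ List A ] Unique l × (∀ a → a ∉ l → f a ≈ 0#)

    -- The sum of all values of a finitely supported function.
    ∑ : (A → ℝ) → ℝ
    ∑ f with em {FinitelySupported f}
    ... | yes (l , _) = sumOver l f
    ... | no _        = 0#

  -- lim_{α → 1⁻} f α = L, for f on [0,1).
  LeftLimitAt1 : (ℝ → ℝ) → ℝ → Set
  LeftLimitAt1 f L =
    ∀ ε → 0# < ε → ∃[ δ ] 0# < δ ×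
      (∀ α → 0# ≤ α → 1# - δ < α → α < 1# → L - ε < f α × f α < L + ε)

  module _ {U : Set} (G : Graph U) where
    open Graph G

    dist : U → U → ℕ
    dist x y with em {∃ (Walk G x y)}
    ... | yes (n , _) = least {Walk G x y} (λ _ → em) n
    ... | no _        = 0

    -- A coupling of finitely supported measures is automatically finitely
    -- supported; the field makes the sums below genuine.
    record IsCoupling (μ ν : U → ℝ) (π : U → U → ℝ) : Set where
      field
        finite    : FinitelySupported (uncurry π)
        nonNeg    : ∀ x y → 0# ≤ π x y
        marginalˡ : ∀ x → ∑ (λ y → π x y) ≈ μ x
        marginalʳ : ∀ y → ∑ (λ x → π x y) ≈ ν y

    cost : (U → U → ℝ) → ℝ
    cost π = ∑ (uncurry (λ x y → dist x y · π x y))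

    W₁ : (μ ν : U → ℝ) → ℝ
    W₁ μ ν = inf (λ c → ∃[ π ] IsCoupling μ ν π × c ≈ cost π)

    -- Only the values on edges carry meaning.
    record Weight : Set where
      field
        w        : U → U → ℝ
        w-sym    : ∀ {x y} → x ∼ y → w x y ≈ w y x
        positive : ∀ {x y} → x ∼ y → 0# < w x y

    module _ (𝓌 : Weight) where
      open Weight 𝓌

      degree : U → ℝ
      degree x = ∑ (λ y → if does (em {x ∼ y}) then w x y else 0#)

      measure : ℝ → U → (U → ℝ)
      measure α x z =
        if does (em {z ≡ x}) then α
        else if does (em {x ∼ z}) then (1# - α) * w x z * degree x ⁻¹
        else 0#

      κ : ℝ → U → U → ℝ
      κ α x y = 1# - W₁ (measure α x) (measure α y)

      -- κ-LLY x y L: the Lin–Lu–Yau curvature of xy exists and equals L.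
      κ-LLY : U → U → ℝ → Set
      κ-LLY x y L = LeftLimitAt1 (λ α → κ α x y * (1# - α) ⁻¹) L

      Admissible : Set
      Admissible = ∀ x y → x ∼ y → ∃[ L ] κ-LLY x y L × 0# ≤ L

      EdgeValue : ℝ → Set
      EdgeValue r = ∃[ x ] ∃[ y ] x ∼ y × r ≈ w x y

      Dist : ℝ ⁺
      Dist with em {∃ (UpperBound EdgeValue) × 0# < inf EdgeValue}
      ... | yes _ = [ sup EdgeValue * inf EdgeValue ⁻¹ ]
      ... | no _  = ⊤⁺

    -- A connected graph without edges is K₁, for which the value is 1 by
    -- convention.
    DN-LLY : ℝ ⁺
    DN-LLY with em {HasEdge G}
    ... | yes _ = inf⁺ (λ D → ∃[ 𝓌 ] Admissible 𝓌 × D ≡ Dist 𝓌)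
    ... | no _  = [ 1# ]

{-# OPTIONS --safe #-}

-- The restriction to H of an admissible weight on G is admissible on H and has
-- no larger distortion. For a tree-like edge xy, every other neighbour of x has
-- distance 2 from y and distance 3 from every other neighbour of y, and vice
-- versa. Hence for α > 1/2 the transport problem is solved exactly by a coupling
-- that is tight for an explicit potential, which gives
--   κ_LLY(x,y) = 2 (w_xy / d_x + w_xy / d_y) - 2.
-- Passing to H keeps w_xy and does not increase the degrees d_x and d_y, so the
-- curvature of the edges of H does not decrease.
module Submission where

open import Defs
open import Level using (0ℓ)
open import Axiom.ExcludedMiddle using (ExcludedMiddle)
open import Algebra.Solver.Ring.AlmostCommutativeRing
  using (fromCommutativeRing; _-Raw-AlmostCommutative⟶_; Induced-equivalence)
open import Data.Bool.Base using (if_then_else_)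
open import Data.Fin.Patterns using (0F; 1F; 2F; 3F; 4F)
open import Data.Integer.Base as ℤ using (-[1+_]; ℤ)
import Data.Integer.Properties as ℤ
open import Data.List.Base using (List; []; _∷_; _++_; cartesianProduct; deduplicate; map)
open import Data.List.Membership.Propositional using (_∈_; _∉_)
open import Data.List.Membership.Propositional.Properties
  using (∈-++⁺ˡ; ∈-++⁺ʳ; ∈-cartesianProduct⁺; ∈-deduplicate⁺; ∈-map⁺)
open import Data.List.Relation.Unary.AllPairs using (_∷_)
open import Data.List.Relation.Unary.Any using (here; there)
import Data.List.Relation.Unary.Unique.DecPropositional.Properties as UniqueDec
open import Data.List.Relation.Unary.Unique.Propositional using (Unique)
open import Data.List.Relation.Unary.Unique.Propositional.Properties
  using (Unique[x∷xs]⇒x∉xs; cartesianProduct⁺)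
open import Data.Maybe.Base using (just; nothing)
open import Data.Nat.Base as ℕ using (ℕ; s<s; s≤s; suc; z<s; zero; z≤n)
import Data.Nat.Properties as ℕ
open import Data.Product.Base using (_,_; _×_; proj₁; proj₂; uncurry; Σ-syntax; ∃; ∃-syntax)
open import Data.Sum.Base using ([_,_]′; _⊎_; inj₁; inj₂)
open import Data.Vec.Base using ([]; _∷_; lookup)
open import Data.Vec.Relation.Unary.All using ([]; _∷_)
open import Data.Vec.Relation.Unary.AllPairs using ([]; _∷_)
open import Data.Vec.Relation.Unary.Unique.Propositional.Properties using (lookup-injective)
open import Function.Base using (_∘_; case_of_)
open import Function.Bundles using (Equivalence)
import Relation.Binary.Construct.Add.Supremum.NonStrict as AddSupremum
import Relation.Binary.Construct.NonStrictToStrict as Strict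
open import Relation.Binary.Definitions using (DecidableEquality; WeaklyDecidable)
open import Relation.Binary.PropositionalEquality.Core as ≡ using (_≡_; _≢_)
open import Relation.Binary.Structures using (IsTotalOrder)
open import Relation.Nullary.Construct.Add.Supremum using ([_]; _⁺)
open import Relation.Nullary.Decidable.Core using (Dec; does; no; yes)
open import Relation.Nullary.Negation.Core using (¬_; contradiction)

-- Distances in `H` may exceed those in `G`, and `H` may lack neighbours that a transport plan in
-- `G` uses, so plans cannot simply be carried over. The comparison goes through exact values
-- instead: tree-likeness passes from `G` to `H`, hence the same formula holds on both sides. The
-- threshold 1/2 has the following origin. Among the pairs of points in the two supports, the
-- potential fails to be tight at `(y , x)` alone, where it descends. The coupling must therefore
-- send nothing from `y` to `x`. The mass to be delivered at `x` is at most `1 - α`, and the mass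
-- `α` already lying there covers it once `α` exceeds 1/2. On this range the quotient in the
-- definition of the curvature is constant, so the limit in `H` exists and the assumed limit in `G`
-- bounds the constant's sign.

-- Ordered-field arithmetic and a ring solver with integer coefficients.

module OrderedField (ℛ : CompleteOrderedField) where

  open CompleteOrderedField ℛ
  open import Algebra.Properties.Ring ring
    using (-‿involutive; -0#≈0#; -‿+-comm; -‿distribˡ-*; -‿distribʳ-*)
  -- With this version of multiples `1 · 1#` reduces to `1#`, so that solver constants match `1#` on
  -- the nose and `1-homo` is `refl`. The transport cost is defined with the plain version.
  open import Algebra.Properties.Semiring.Mult.TCOptimised semiring
    using (×-homo-+; ×1-homo-*; 1+×) renaming (_×_ to _·_)
  open import Relation.Binary.Reasoning.Setoid setoid

  -- The ring solver takes its coefficients in ℤ, since equality of reals does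
  -- not compute.
  ι : ℤ → Carrier
  ι (ℤ.+ n)  = n · 1#
  ι -[1+ n ] = - (suc n · 1#)

  ι-⊖ : ∀ m n → ι (m ℤ.⊖ n) ≈ m · 1# - n · 1#
  ι-⊖ zero    zero    = sym (-‿inverseʳ 0#)
  ι-⊖ zero    (suc n) = sym (+-identityˡ _)
  ι-⊖ (suc m) zero    = sym (trans (+-congˡ -0#≈0#) (+-identityʳ _))
  ι-⊖ (suc m) (suc n) = begin
    ι (suc m ℤ.⊖ suc n)                  ≡⟨ ≡.cong ι (ℤ.[1+m]⊖[1+n]≡m⊖n m n) ⟩
    ι (m ℤ.⊖ n)                          ≈⟨ ι-⊖ m n ⟩
    m · 1# - n · 1#                      ≈⟨ +-identityˡ _ ⟨
    0# + (m · 1# - n · 1#)               ≈⟨ +-congʳ (-‿inverseʳ 1#) ⟨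
    (1# - 1#) + (m · 1# - n · 1#)        ≈⟨ +-assoc _ _ _ ⟩
    1# + (- 1# + (m · 1# - n · 1#))      ≈⟨ +-congˡ (+-assoc _ _ _) ⟨
    1# + (- 1# + m · 1# - n · 1#)        ≈⟨ +-congˡ (+-congʳ (+-comm _ _)) ⟩
    1# + (m · 1# - 1# - n · 1#)          ≈⟨ +-congˡ (+-assoc _ _ _) ⟩
    1# + (m · 1# + (- 1# - n · 1#))      ≈⟨ +-assoc _ _ _ ⟨
    1# + m · 1# + (- 1# - n · 1#)        ≈⟨ +-congˡ (-‿+-comm 1# (n · 1#)) ⟩
    1# + m · 1# - (1# + n · 1#)          ≈⟨ +-cong (1+× m 1#) (-‿cong (1+× n 1#)) ⟨
    suc m · 1# - suc n · 1#              ∎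

  ι-neg : ∀ i → ι (ℤ.- i) ≈ - ι i
  ι-neg (ℤ.+ zero)  = sym -0#≈0#
  ι-neg (ℤ.+ suc n) = refl
  ι-neg -[1+ n ]    = sym (-‿involutive _)

  ι-+ : ∀ i j → ι (i ℤ.+ j) ≈ ι i + ι j
  ι-+ (ℤ.+ m)  (ℤ.+ n)  = ×-homo-+ 1# m n
  ι-+ (ℤ.+ m)  -[1+ n ] = ι-⊖ m (suc n)
  ι-+ -[1+ m ] (ℤ.+ n)  = trans (ι-⊖ n (suc m)) (+-comm _ _)
  ι-+ -[1+ m ] -[1+ n ] = begin
    - (suc (suc (m ℕ.+ n)) · 1#)       ≡⟨ ≡.cong (λ k → - (k · 1#)) (≡.sym (ℕ.+-suc (suc m) n)) ⟩
    - ((suc m ℕ.+ suc n) · 1#)         ≈⟨ -‿cong (×-homo-+ 1# (suc m) (suc n)) ⟩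
    - (suc m · 1# + suc n · 1#)        ≈⟨ -‿+-comm _ _ ⟨
    - (suc m · 1#) - suc n · 1#        ∎

  ι-+* : ∀ m j → ι (ℤ.+ m ℤ.* j) ≈ m · 1# * ι j
  ι-+* m (ℤ.+ n)  = begin
    ι (ℤ.+ m ℤ.* ℤ.+ n)                ≡⟨ ≡.cong ι (≡.sym (ℤ.pos-* m n)) ⟩
    (m ℕ.* n) · 1#                     ≈⟨ ×1-homo-* m n ⟩
    (m · 1#) * (n · 1#)                ∎
  ι-+* m -[1+ n ] = begin
    ι (ℤ.+ m ℤ.* -[1+ n ])             ≡⟨ ≡.cong ι (≡.sym (ℤ.neg-distribʳ-* (ℤ.+ m) (ℤ.+ suc n))) ⟩
    ι (ℤ.- (ℤ.+ m ℤ.* ℤ.+ suc n))      ≈⟨ ι-neg (ℤ.+ m ℤ.* ℤ.+ suc n) ⟩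
    - ι (ℤ.+ m ℤ.* ℤ.+ suc n)          ≈⟨ -‿cong (ι-+* m (ℤ.+ suc n)) ⟩
    - (m · 1# * (suc n · 1#))          ≈⟨ -‿distribʳ-* _ _ ⟩
    m · 1# * - (suc n · 1#)            ∎

  ι-* : ∀ i j → ι (i ℤ.* j) ≈ ι i * ι j
  ι-* (ℤ.+ m)  j = ι-+* m j
  ι-* -[1+ m ] j = begin
    ι (-[1+ m ] ℤ.* j)                 ≡⟨ ≡.cong ι (≡.sym (ℤ.neg-distribˡ-* (ℤ.+ suc m) j)) ⟩
    ι (ℤ.- (ℤ.+ suc m ℤ.* j))          ≈⟨ ι-neg (ℤ.+ suc m ℤ.* j) ⟩
    - ι (ℤ.+ suc m ℤ.* j)              ≈⟨ -‿cong (ι-+* (suc m) j) ⟩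
    - (suc m · 1# * ι j)               ≈⟨ -‿distribˡ-* _ _ ⟩
    - (suc m · 1#) * ι j               ∎

  private
    almostCommutativeRing = fromCommutativeRing commutativeRing

    ι-morphism : ℤ.+-*-rawRing -Raw-AlmostCommutative⟶ almostCommutativeRing
    ι-morphism = record
      { ⟦_⟧    = ι
      ; +-homo = ι-+
      ; *-homo = ι-*
      ; -‿homo = ι-neg
      ; 0-homo = refl
      ; 1-homo = refl
      }

    _coeff≟_ : WeaklyDecidable (Induced-equivalence ι-morphism)
    i coeff≟ j with i ℤ.≟ j
    ... | yes i≡j = just (reflexive (≡.cong ι i≡j))
    ... | no _    = nothing

  module Solver where
    open import Algebra.Solver.Ring ℤ.+-*-rawRing almostCommutativeRing ι-morphism _coeff≟_ public

  open Solver using (solve; con; _:+_; _:*_; _:-_; :-_; _:=_) public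

  𝟎 𝟏 𝟐 : ∀ {n} → Solver.Polynomial n
  𝟎 = con ℤ.0ℤ
  𝟏 = con ℤ.1ℤ
  𝟐 = 𝟏 :+ 𝟏

  open IsTotalOrder isTotalOrder public
    using (total; antisym; ≤-respˡ-≈; ≤-respʳ-≈)
    renaming (refl to ≤-refl; reflexive to ≤-reflexive; trans to ≤-trans)

  open Strict _≈_ _≤_ public using (<⇒≤)

  <-respˡ-≈ : ∀ {x y z} → x ≈ y → x < z → y < z
  <-respˡ-≈ = Strict.<-respˡ-≈ _≈_ _≤_ trans ≤-respˡ-≈

  <-respʳ-≈ : ∀ {x y z} → x ≈ y → z < x → z < y
  <-respʳ-≈ = Strict.<-respʳ-≈ _≈_ _≤_ sym trans ≤-respʳ-≈

  <⇒≱ : ∀ {x y} → x < y → ¬ y ≤ x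
  <⇒≱ = Strict.<⇒≱ _≈_ _≤_ antisym

  <-≤-trans : ∀ {x y z} → x < y → y ≤ z → x < z
  <-≤-trans = Strict.<-≤-trans _≈_ _≤_ sym ≤-trans antisym ≤-respʳ-≈

  ≤-<-trans : ∀ {x y z} → x ≤ y → y < z → x < z
  ≤-<-trans = Strict.≤-<-trans _≈_ _≤_ ≤-trans antisym ≤-respˡ-≈

  ≰⇒> : ∀ {x y} → ¬ x ≤ y → y < x
  ≰⇒> = Strict.≰⇒> _≈_ _≤_ sym ≤-reflexive total

  -- The free `z` lets the difference be given in a form whose sign is evident, leaving an identity
  -- for the ring solver. Most inequalities below are proved through this lemma or its strict
  -- variant.
  y-x≥0⇒x≤y : ∀ {x y z} → 0# ≤ z → z ≈ y - x → x ≤ y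
  y-x≥0⇒x≤y {x} {y} {z} 0≤z z≈y-x = ≤-respˡ-≈ (+-identityʳ x)
    (≤-respʳ-≈ (trans (+-congˡ z≈y-x) (solve 2 (λ x y → x :+ (y :- x) := y) refl x y))
      (+-monoʳ-≤ x 0≤z))

  y-x>0⇒x<y : ∀ {x y z} → 0# < z → z ≈ y - x → x < y
  y-x>0⇒x<y {x} {y} (0≤z , 0≉z) z≈y-x = y-x≥0⇒x≤y 0≤z z≈y-x , λ x≈y →
    0≉z (sym (trans z≈y-x (trans (+-congʳ (sym x≈y)) (-‿inverseʳ x))))

  x≤y⇒0≤y-x : ∀ {x y} → x ≤ y → 0# ≤ y - x
  x≤y⇒0≤y-x {x} {y} x≤y =
    ≤-respˡ-≈ (-‿inverseˡ x) (≤-respʳ-≈ (+-comm (- x) y) (+-monoʳ-≤ (- x) x≤y))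

  x<y⇒0<y-x : ∀ {x y} → x < y → 0# < y - x
  x<y⇒0<y-x {x} {y} (x≤y , x≉y) = x≤y⇒0≤y-x x≤y , λ 0≈y-x → x≉y
    (trans (sym (+-identityʳ x)) (trans (+-congˡ 0≈y-x)
      (solve 2 (λ x y → x :+ (y :- x) := y) refl x y)))

  +-mono-≤ : ∀ {x y u v} → x ≤ y → u ≤ v → x + u ≤ y + v
  +-mono-≤ {x} {y} {u} {v} x≤y u≤v = ≤-trans (+-monoʳ-≤ x u≤v)
    (≤-respˡ-≈ (+-comm v x) (≤-respʳ-≈ (+-comm v y) (+-monoʳ-≤ v x≤y)))

  +-nonNeg : ∀ {x y} → 0# ≤ x → 0# ≤ y → 0# ≤ x + y
  +-nonNeg 0≤x 0≤y = ≤-respˡ-≈ (+-identityˡ 0#) (+-mono-≤ 0≤x 0≤y)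

  +-pos-nonNeg : ∀ {x y} → 0# < x → 0# ≤ y → 0# < x + y
  +-pos-nonNeg {x} {y} 0<x 0≤y = <-≤-trans 0<x
    (≤-respˡ-≈ (+-identityʳ x) (+-monoʳ-≤ x 0≤y))

  neg-mono-≤ : ∀ {x y} → x ≤ y → - y ≤ - x
  neg-mono-≤ {x} {y} x≤y = y-x≥0⇒x≤y (x≤y⇒0≤y-x x≤y)
    (solve 2 (λ x y → y :- x := (:- x) :- (:- y)) refl x y)

  *-monoˡ-≤ : ∀ {x y z} → 0# ≤ z → x ≤ y → x * z ≤ y * z
  *-monoˡ-≤ {x} {y} {z} 0≤z x≤y = y-x≥0⇒x≤y (*-nonNeg (x≤y⇒0≤y-x x≤y) 0≤z)
    (solve 3 (λ x y z → (y :- x) :* z := y :* z :- x :* z) refl x y z)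

  *-monoʳ-≤ : ∀ {x y z} → 0# ≤ z → x ≤ y → z * x ≤ z * y
  *-monoʳ-≤ 0≤z x≤y =
    ≤-respˡ-≈ (*-comm _ _) (≤-respʳ-≈ (*-comm _ _) (*-monoˡ-≤ 0≤z x≤y))

  *-pos : ∀ {x y} → 0# < x → 0# < y → 0# < x * y
  *-pos {x} {y} (0≤x , 0≉x) (0≤y , 0≉y) = *-nonNeg 0≤x 0≤y , λ 0≈xy → 0≉y (begin
    0#              ≈⟨ zeroʳ (x ⁻¹) ⟨
    x ⁻¹ * 0#       ≈⟨ *-congˡ 0≈xy ⟩
    x ⁻¹ * (x * y)  ≈⟨ *-assoc _ _ _ ⟨
    x ⁻¹ * x * y    ≈⟨ *-congʳ (*-comm _ _) ⟩
    x * x ⁻¹ * y    ≈⟨ *-congʳ (inverseʳ x (0≉x ∘ sym)) ⟩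
    1# * y          ≈⟨ *-identityˡ y ⟩
    y               ∎)

  0≤1 : 0# ≤ 1#
  0≤1 with total 0# 1#
  ... | inj₁ 0≤1 = 0≤1
  ... | inj₂ 1≤0 = ≤-respʳ-≈
    (solve 0 ((:- 𝟏) :* (:- 𝟏) := 𝟏) refl) (*-nonNeg 0≤-1 0≤-1)
    where
    0≤-1 : 0# ≤ - 1#
    0≤-1 = ≤-respˡ-≈ -0#≈0# (neg-mono-≤ 1≤0)

  0<1 : 0# < 1#
  0<1 = 0≤1 , 1≉0 ∘ sym

  x*x⁻¹≈1 : ∀ {x} → 0# < x → x * x ⁻¹ ≈ 1#
  x*x⁻¹≈1 {x} (_ , 0≉x) = inverseʳ x (0≉x ∘ sym)

  ⁻¹-pos : ∀ {x} → 0# < x → 0# < x ⁻¹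
  ⁻¹-pos {x} 0<x with total 0# (x ⁻¹)
  ... | inj₁ 0≤x⁻¹ = 0≤x⁻¹ , λ 0≈x⁻¹ →
    1≉0 (trans (sym (x*x⁻¹≈1 0<x)) (trans (*-congˡ (sym 0≈x⁻¹)) (zeroʳ x)))
  ... | inj₂ x⁻¹≤0 = contradiction
    (≤-respˡ-≈ (x*x⁻¹≈1 0<x) (≤-respʳ-≈ (zeroʳ x) (*-monoʳ-≤ (<⇒≤ 0<x) x⁻¹≤0))) (<⇒≱ 0<1)

  ⁻¹-anti-≤ : ∀ {x y} → 0# < x → x ≤ y → y ⁻¹ ≤ x ⁻¹
  ⁻¹-anti-≤ {x} {y} 0<x x≤y = y-x≥0⇒x≤y
    (*-nonNeg (x≤y⇒0≤y-x x≤y) (*-nonNeg (<⇒≤ (⁻¹-pos 0<x)) (<⇒≤ (⁻¹-pos 0<y)))) (begin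
    (y - x) * (x ⁻¹ * y ⁻¹)
      ≈⟨ solve 4 (λ x y u v → (y :- x) :* (u :* v) := (y :* v) :* u :- (x :* u) :* v)
           refl x y (x ⁻¹) (y ⁻¹) ⟩
    y * y ⁻¹ * x ⁻¹ - x * x ⁻¹ * y ⁻¹
      ≈⟨ +-cong (*-congʳ (x*x⁻¹≈1 0<y)) (-‿cong (*-congʳ (x*x⁻¹≈1 0<x))) ⟩
    1# * x ⁻¹ - 1# * y ⁻¹
      ≈⟨ +-cong (*-identityˡ _) (-‿cong (*-identityˡ _)) ⟩
    x ⁻¹ - y ⁻¹ ∎)
    where
    0<y : 0# < y
    0<y = <-≤-trans 0<x x≤y

  2# ½ : Carrier
  2# = 1# + 1#
  ½  = 2# ⁻¹

  0<2 : 0# < 2#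
  0<2 = +-pos-nonNeg 0<1 0≤1

  0<½ : 0# < ½
  0<½ = ⁻¹-pos 0<2

  ½+½≈1 : ½ + ½ ≈ 1#
  ½+½≈1 = trans (solve 1 (λ h → h :+ h := 𝟐 :* h) refl ½) (x*x⁻¹≈1 0<2)

-- Finite sums and Kronecker deltas.

module FiniteSums (em : ExcludedMiddle 0ℓ) (ℛ : CompleteOrderedField) where

  open Curvature em ℛ
  open CompleteOrderedField ℛ renaming (Carrier to ℝ)
  open OrderedField ℛ
  open import Algebra.Properties.Ring ring using (-0#≈0#; -‿+-comm)
  open import Relation.Binary.Reasoning.Setoid setoid

  infix 4 _≟_
  _≟_ : {A : Set} → DecidableEquality A
  a ≟ b = em

  -- `em` does not compute, so the conditionals in `degree` and `measure` have to be resolved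
  -- propositionally.
  if-yes : {P X : Set} {x y : X} → P → (if does (em {P}) then x else y) ≡ x
  if-yes {P} p with em {P}
  ... | yes _ = ≡.refl
  ... | no ¬p = contradiction p ¬p

  if-no : {P X : Set} {x y : X} → ¬ P → (if does (em {P}) then x else y) ≡ y
  if-no {P} ¬p with em {P}
  ... | yes p = contradiction p ¬p
  ... | no _  = ≡.refl

  distinct : {A : Set} (l : List A) → Σ[ m ∈ List A ] Unique m × (∀ {a} → a ∈ l → a ∈ m)
  distinct l = deduplicate _≟_ l , UniqueDec.deduplicate-! _≟_ l , ∈-deduplicate⁺ _≟_

  module _ {A : Set} where

    sumOver-cong : (l : List A) {f g : A → ℝ} → (∀ a → f a ≈ g a) → sumOver l f ≈ sumOver l g
    sumOver-cong []      f≈g = refl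
    sumOver-cong (a ∷ l) f≈g = +-cong (f≈g a) (sumOver-cong l f≈g)

    sumOver-mono : (l : List A) {f g : A → ℝ} → (∀ a → f a ≤ g a) → sumOver l f ≤ sumOver l g
    sumOver-mono []      f≤g = ≤-refl
    sumOver-mono (a ∷ l) f≤g = +-mono-≤ (f≤g a) (sumOver-mono l f≤g)

    sumOver-0 : (l : List A) → sumOver l (λ _ → 0#) ≈ 0#
    sumOver-0 []      = refl
    sumOver-0 (a ∷ l) = trans (+-identityˡ _) (sumOver-0 l)

    sumOver-+ : (l : List A) (f g : A → ℝ) →
                sumOver l (λ a → f a + g a) ≈ sumOver l f + sumOver l g
    sumOver-+ []      f g = sym (+-identityˡ 0#)
    sumOver-+ (a ∷ l) f g = trans (+-congˡ (sumOver-+ l f g))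
      (solve 4 (λ a b c d → a :+ b :+ (c :+ d) := a :+ c :+ (b :+ d)) refl
        (f a) (g a) (sumOver l f) (sumOver l g))

    sumOver-*ˡ : (l : List A) (c : ℝ) (f : A → ℝ) → sumOver l (λ a → c * f a) ≈ c * sumOver l f
    sumOver-*ˡ []      c f = sym (zeroʳ c)
    sumOver-*ˡ (a ∷ l) c f = trans (+-congˡ (sumOver-*ˡ l c f)) (sym (distribˡ c _ _))

    sumOver-neg : (l : List A) (f : A → ℝ) → sumOver l (λ a → - f a) ≈ - sumOver l f
    sumOver-neg []      f = sym -0#≈0#
    sumOver-neg (a ∷ l) f = trans (+-congˡ (sumOver-neg l f)) (-‿+-comm _ _)

    sumOver-nonNeg : (l : List A) {f : A → ℝ} → (∀ a → 0# ≤ f a) → 0# ≤ sumOver l f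
    sumOver-nonNeg []      0≤f = ≤-refl
    sumOver-nonNeg (a ∷ l) 0≤f = +-nonNeg (0≤f a) (sumOver-nonNeg l 0≤f)

    term≤sumOver : (l : List A) {f : A → ℝ} → (∀ a → 0# ≤ f a) → ∀ {a} → a ∈ l → f a ≤ sumOver l f
    term≤sumOver (a ∷ l) {f} 0≤f (here ≡.refl) = ≤-respˡ-≈ (+-identityʳ (f a))
      (+-monoʳ-≤ (f a) (sumOver-nonNeg l 0≤f))
    term≤sumOver (b ∷ l) {f} 0≤f (there a∈l)   = ≤-respˡ-≈ (+-identityˡ _)
      (+-mono-≤ (0≤f b) (term≤sumOver l 0≤f a∈l))

    sumOver-++ : (l m : List A) (f : A → ℝ) → sumOver (l ++ m) f ≈ sumOver l f + sumOver m f
    sumOver-++ []      m f = sym (+-identityˡ _)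
    sumOver-++ (a ∷ l) m f = trans (+-congˡ (sumOver-++ l m f)) (sym (+-assoc _ _ _))

    sumOver-map : {B : Set} (l : List B) (h : B → A) (f : A → ℝ) →
                  sumOver (map h l) f ≡ sumOver l (f ∘ h)
    sumOver-map []      h f = ≡.refl
    sumOver-map (b ∷ l) h f = ≡.cong (f (h b) +_) (sumOver-map l h f)

  sumOver-swap : {A B : Set} (l : List A) (m : List B) (f : A → B → ℝ) →
    sumOver l (λ a → sumOver m (f a)) ≈ sumOver m (λ b → sumOver l (λ a → f a b))
  sumOver-swap []      m f = sym (sumOver-0 m)
  sumOver-swap (a ∷ l) m f = trans (+-congˡ (sumOver-swap l m f)) (sym (sumOver-+ m _ _))

  module _ {A : Set} where

    -- The test is `b ≡ a` in this order because `measure` and the potentials test their argument in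
    -- the same way; a single case split on `em` then resolves both.
    δ : A → A → ℝ
    δ a b = if does (em {b ≡ a}) then 1# else 0#

    δ-diag : ∀ {a b} → b ≡ a → δ a b ≡ 1#
    δ-diag = if-yes

    δ-off : ∀ {a b} → ¬ b ≡ a → δ a b ≡ 0#
    δ-off = if-no

    δ-nonNeg : ∀ a b → 0# ≤ δ a b
    δ-nonNeg a b with em {b ≡ a}
    ... | yes _ = 0≤1
    ... | no _  = ≤-refl

    δ-swap : ∀ a b (f : A → ℝ) → δ a b * f b ≈ δ b a * f a
    δ-swap a b f with em {b ≡ a} | em {a ≡ b}
    ... | yes ≡.refl | yes _   = refl
    ... | yes b≡a    | no a≢b  = contradiction (≡.sym b≡a) a≢b
    ... | no b≢a     | yes a≡b = contradiction (≡.sym a≡b) b≢a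
    ... | no _       | no _    = trans (zeroˡ _) (sym (zeroˡ _))

    sumOver-δ-∉ : ∀ {l a} → a ∉ l → (f : A → ℝ) → sumOver l (λ b → δ a b * f b) ≈ 0#
    sumOver-δ-∉ {[]}    a∉l f = refl
    sumOver-δ-∉ {b ∷ l} a∉l f = trans (+-cong
      (trans (*-congʳ (reflexive (δ-off (a∉l ∘ here ∘ ≡.sym)))) (zeroˡ _))
      (sumOver-δ-∉ (a∉l ∘ there) f)) (+-identityˡ 0#)

    sumOver-δ : ∀ {l a} → Unique l → a ∈ l → (f : A → ℝ) → sumOver l (λ b → δ a b * f b) ≈ f a
    sumOver-δ {b ∷ l} {a} u (here ≡.refl) f = trans (+-cong
      (trans (*-congʳ (reflexive (δ-diag ≡.refl))) (*-identityˡ _))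
      (sumOver-δ-∉ (Unique[x∷xs]⇒x∉xs u) f)) (+-identityʳ _)
    sumOver-δ {b ∷ l} {a} u@(_ ∷ u′) (there a∈l) f = trans (+-cong
      (trans (*-congʳ (reflexive (δ-off λ { ≡.refl → Unique[x∷xs]⇒x∉xs u a∈l }))) (zeroˡ _))
      (sumOver-δ u′ a∈l f)) (+-identityˡ _)

    sumOver-δ-1 : ∀ {l a} → Unique l → a ∈ l → sumOver l (δ a) ≈ 1#
    sumOver-δ-1 {l} {a} u a∈l = trans
      (sumOver-cong l (λ b → sym (*-identityʳ (δ a b)))) (sumOver-δ u a∈l (λ _ → 1#))

    SupportedOn : List A → (A → ℝ) → Set
    SupportedOn l f = ∀ a → a ∉ l → f a ≈ 0#

    sumOver-δ-supported : ∀ {l f} → Unique l → SupportedOn l f → ∀ a →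
                          sumOver l (λ b → δ a b * f b) ≈ f a
    sumOver-δ-supported {l} {f} u f↾l a with em {a ∈ l}
    ... | yes a∈l = sumOver-δ u a∈l f
    ... | no a∉l  = trans (sumOver-δ-∉ a∉l f) (sym (f↾l a a∉l))

    -- `∑` sums over whichever list excluded middle returns, and this makes its value computable
    -- from any other. Writing each value as a `δ`-sum over the other list and exchanging the sums
    -- avoids reasoning about permutations.
    sumOver-unique : ∀ {l m f} → Unique l → SupportedOn l f → Unique m → SupportedOn m f →
                     sumOver l f ≈ sumOver m f
    sumOver-unique {l} {m} {f} ul fl um fm = begin
      sumOver l f                                    ≈⟨ sumOver-cong l (sumOver-δ-supported um fm) ⟨
      sumOver l (λ a → sumOver m (λ b → δ a b * f b)) ≈⟨ sumOver-swap l m _ ⟩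
      sumOver m (λ b → sumOver l (λ a → δ a b * f b)) ≈⟨ sumOver-cong m (λ b → sumOver-cong l (λ a → δ-swap a b f)) ⟩
      sumOver m (λ b → sumOver l (λ a → δ b a * f a)) ≈⟨ sumOver-cong m (sumOver-δ-supported ul fl) ⟩
      sumOver m f                                    ∎

    ∑≈sumOver : ∀ {l f} → Unique l → SupportedOn l f → ∑ f ≈ sumOver l f
    ∑≈sumOver {l} {f} u f↾l with em {FinitelySupported f}
    ... | yes (m , um , fm) = sumOver-unique um fm u f↾l
    ... | no ¬fin           = contradiction (l , u , f↾l) ¬fin

  sumOver-cartesianProduct : {A B : Set} (l : List A) (m : List B) (f : A → B → ℝ) →
    sumOver (cartesianProduct l m) (uncurry f) ≈ sumOver l (λ a → sumOver m (f a))
  sumOver-cartesianProduct []      m f = refl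
  sumOver-cartesianProduct (a ∷ l) m f = trans
    (sumOver-++ (map (a ,_) m) (cartesianProduct l m) (uncurry f))
    (+-cong (reflexive (sumOver-map m (a ,_) (uncurry f))) (sumOver-cartesianProduct l m f))

-- Infima and optimal transport between finitely supported measures.

module Transport (em : ExcludedMiddle 0ℓ) (ℛ : CompleteOrderedField) where

  open Curvature em ℛ
  open CompleteOrderedField ℛ renaming (Carrier to ℝ)
  open OrderedField ℛ
  open FiniteSums em ℛ
  open import Algebra.Properties.Ring ring using (-‿involutive; -0#≈0#; -‿distribˡ-*)
  open import Algebra.Properties.Semiring.Mult semiring
    using (×-homo-+; ×-assoc-*; ×-congʳ) renaming (_×_ to _·_)
  open import Relation.Binary.Reasoning.Setoid setoid

  sup-isSup : ∀ {P} → ∃ P → ∃ (UpperBound P) → IsSup P (sup P)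
  sup-isSup {P} inhabited bounded with em {∃ P × ∃ (UpperBound P)}
  ... | yes (i , b) = proj₂ (complete P i b)
  ... | no ¬both    = contradiction (inhabited , bounded) ¬both

  LowerBound : (ℝ → Set) → ℝ → Set
  LowerBound P b = ∀ x → P x → b ≤ x

  inf-isInf : ∀ {P} → ∃ P → ∃ (LowerBound P) →
              LowerBound P (inf P) × (∀ b → LowerBound P b → b ≤ inf P)
  inf-isInf {P} (x , Px) (b , b≤P) = lower , greatest
    where
    Neg : ℝ → Set
    Neg r = ∃[ s ] P s × r ≈ - s

    negBound : ∀ {c} → LowerBound P c → UpperBound Neg (- c)
    negBound c≤P r (s , Ps , r≈-s) = ≤-respˡ-≈ (sym r≈-s) (neg-mono-≤ (c≤P s Ps))

    isSup : IsSup Neg (sup Neg)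
    isSup = sup-isSup (- x , x , Px , refl) (- b , negBound b≤P)

    lower : LowerBound P (inf P)
    lower s Ps = ≤-respʳ-≈ (-‿involutive s) (neg-mono-≤ (proj₁ isSup (- s) (s , Ps , refl)))

    greatest : ∀ c → LowerBound P c → c ≤ inf P
    greatest c c≤P = ≤-respˡ-≈ (-‿involutive c) (neg-mono-≤ (proj₂ isSup (- c) (negBound c≤P)))

  inf-min : ∀ {P m} → P m → LowerBound P m → inf P ≈ m
  inf-min {P} {m} Pm m≤P = antisym (proj₁ isInf m Pm) (proj₂ isInf m m≤P)
    where isInf = inf-isInf (m , Pm) (m , m≤P)

  ·-as-* : ∀ n r → n · r ≈ n · 1# * r
  ·-as-* n r = sym (trans (×-assoc-* n 1# r) (×-congʳ n (*-identityˡ r)))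

  ·1-nonNeg : ∀ n → 0# ≤ n · 1#
  ·1-nonNeg zero    = ≤-refl
  ·1-nonNeg (suc n) = +-nonNeg 0≤1 (·1-nonNeg n)

  ·1-mono : ∀ {m n} → m ℕ.≤ n → m · 1# ≤ n · 1#
  ·1-mono {m} {n} m≤n = ≡.subst (λ k → m · 1# ≤ k · 1#) (ℕ.m+[n∸m]≡n m≤n)
    (≤-respˡ-≈ (+-identityʳ _) (≤-respʳ-≈ (sym (×-homo-+ 1# m (n ℕ.∸ m)))
      (+-monoʳ-≤ (m · 1#) (·1-nonNeg (n ℕ.∸ m)))))

  -- A single duplicate-free list carrying both measures turns marginals and costs into sums over
  -- the same index set, which can be exchanged freely.
  module _ {U : Set} (G : Graph U) {S : List U} (uS : Unique S)
           {μ ν : U → ℝ} (μ↾S : SupportedOn S μ) (ν↾S : SupportedOn S ν) where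

    coupling : {π : U → U → ℝ} → (∀ a b → 0# ≤ π a b) →
      (∀ a → a ∉ S → ∀ b → π a b ≈ 0#) → (∀ b → b ∉ S → ∀ a → π a b ≈ 0#) →
      (∀ a → sumOver S (π a) ≈ μ a) → (∀ b → sumOver S (λ a → π a b) ≈ ν b) →
      IsCoupling G μ ν π
    coupling 0≤π π↾ˡ π↾ʳ Σˡ Σʳ = record
      { finite    = cartesianProduct S S , cartesianProduct⁺ uS uS , outside
      ; nonNeg    = 0≤π
      ; marginalˡ = λ a → trans (∑≈sumOver uS (λ b b∉S → π↾ʳ b b∉S a)) (Σˡ a)
      ; marginalʳ = λ b → trans (∑≈sumOver uS (λ a a∉S → π↾ˡ a a∉S b)) (Σʳ b)
      }
      where
      outside : ∀ ab → ab ∉ cartesianProduct S S → _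
      outside (a , b) ab∉S×S with em {a ∈ S}
      ... | yes a∈S = π↾ʳ b (λ b∈S → ab∉S×S (∈-cartesianProduct⁺ a∈S b∈S)) a
      ... | no a∉S  = π↾ˡ a a∉S b

    module _ {π : U → U → ℝ} (c : IsCoupling G μ ν π) where
      open IsCoupling c

      -- At first `π` is only known to vanish off some unknown list of pairs. The second coordinates
      -- of these pairs carry the row `π a`, so `marginalˡ` becomes a sum of nonnegative terms, one
      -- of which is `π a b`. The bound forces `π` to vanish wherever `μ` does, and with its mirror
      -- image `S` can replace the unknown list.
      coupling-≤ˡ : ∀ a b → π a b ≤ μ a
      coupling-≤ˡ a b with finite
      ... | l , _ , π↾l with distinct (map proj₂ l)
      ... | m , um , ⊆m = ≤-respʳ-≈ (trans (sym (∑≈sumOver um π↾m)) (marginalˡ a)) π≤Σ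
        where
        π↾m : SupportedOn m (π a)
        π↾m b b∉m = π↾l (a , b) (b∉m ∘ ⊆m ∘ ∈-map⁺ proj₂)
        π≤Σ : π a b ≤ sumOver m (π a)
        π≤Σ with em {b ∈ m}
        ... | yes b∈m = term≤sumOver m (nonNeg a) b∈m
        ... | no b∉m  = ≤-respˡ-≈ (sym (π↾m b b∉m)) (sumOver-nonNeg m (nonNeg a))

      coupling-≤ʳ : ∀ a b → π a b ≤ ν b
      coupling-≤ʳ a b with finite
      ... | l , _ , π↾l with distinct (map proj₁ l)
      ... | m , um , ⊆m = ≤-respʳ-≈ (trans (sym (∑≈sumOver um π↾m)) (marginalʳ b)) π≤Σ
        where
        π↾m : SupportedOn m (λ a → π a b)
        π↾m a a∉m = π↾l (a , b) (a∉m ∘ ⊆m ∘ ∈-map⁺ proj₁)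
        π≤Σ : π a b ≤ sumOver m (λ a → π a b)
        π≤Σ with em {a ∈ m}
        ... | yes a∈m = term≤sumOver m (λ a → nonNeg a b) a∈m
        ... | no a∉m  = ≤-respˡ-≈ (sym (π↾m a a∉m)) (sumOver-nonNeg m (λ a → nonNeg a b))

      coupling-zeroˡ : ∀ {a} → μ a ≈ 0# → ∀ b → π a b ≈ 0#
      coupling-zeroˡ {a} μa≈0 b = antisym (≤-respʳ-≈ μa≈0 (coupling-≤ˡ a b)) (nonNeg a b)

      coupling-zeroʳ : ∀ {b} → ν b ≈ 0# → ∀ a → π a b ≈ 0#
      coupling-zeroʳ {b} νb≈0 a = antisym (≤-respʳ-≈ νb≈0 (coupling-≤ʳ a b)) (nonNeg a b)

      sumOver-marginalˡ : ∀ a → sumOver S (π a) ≈ μ a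
      sumOver-marginalˡ a = trans
        (sym (∑≈sumOver uS (λ b b∉S → coupling-zeroʳ (ν↾S b b∉S) a))) (marginalˡ a)

      sumOver-marginalʳ : ∀ b → sumOver S (λ a → π a b) ≈ ν b
      sumOver-marginalʳ b = trans
        (sym (∑≈sumOver uS (λ a a∉S → coupling-zeroˡ (μ↾S a a∉S) b))) (marginalʳ b)

      cost≈sumOver : cost G π ≈ sumOver S (λ a → sumOver S (λ b → dist G a b · π a b))
      cost≈sumOver = trans (∑≈sumOver (cartesianProduct⁺ uS uS) outside)
                           (sumOver-cartesianProduct S S _)
        where
        ·0 : ∀ n {r} → r ≈ 0# → n · r ≈ 0#
        ·0 n {r} r≈0 = trans (·-as-* n r) (trans (*-congˡ r≈0) (zeroʳ _))
        outside : ∀ ab → ab ∉ cartesianProduct S S → _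
        outside (a , b) ab∉S×S with em {a ∈ S}
        ... | yes a∈S = ·0 (dist G a b) (coupling-zeroʳ (ν↾S b (λ b∈S → ab∉S×S (∈-cartesianProduct⁺ a∈S b∈S))) a)
        ... | no a∉S  = ·0 (dist G a b) (coupling-zeroˡ (μ↾S a a∉S) b)

      -- This is the dual side of the transport problem: integrating `v b - u a` sees only the
      -- marginals, so all couplings give the same value.
      sumOver-potential : (u v : U → ℕ) →
        sumOver S (λ a → sumOver S (λ b → (v b · 1# - u a · 1#) * π a b))
          ≈ sumOver S (λ b → v b · ν b) - sumOver S (λ a → u a · μ a)
      sumOver-potential u v = begin
        sumOver S (λ a → sumOver S (λ b → (v b · 1# - u a · 1#) * π a b))
          ≈⟨ sumOver-cong S (λ a → trans (sumOver-cong S (λ b → split a b)) (sumOver-+ S _ _)) ⟩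
        sumOver S (λ a → sumOver S (λ b → v b · 1# * π a b)
                       + sumOver S (λ b → - (u a · 1#) * π a b))
          ≈⟨ sumOver-+ S _ _ ⟩
        sumOver S (λ a → sumOver S (λ b → v b · 1# * π a b))
          + sumOver S (λ a → sumOver S (λ b → - (u a · 1#) * π a b))
          ≈⟨ +-cong (trans (sumOver-swap S S _) (sumOver-cong S Σʳ))
                    (trans (sumOver-cong S Σˡ) (sumOver-neg S _)) ⟩
        sumOver S (λ b → v b · ν b) - sumOver S (λ a → u a · μ a) ∎
        where
        split : ∀ a b → (v b · 1# - u a · 1#) * π a b ≈ v b · 1# * π a b + - (u a · 1#) * π a b
        split a b = distribʳ (π a b) (v b · 1#) (- (u a · 1#))
        Σʳ : ∀ b → sumOver S (λ a → v b · 1# * π a b) ≈ v b · ν b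
        Σʳ b = begin
          sumOver S (λ a → v b · 1# * π a b) ≈⟨ sumOver-*ˡ S (v b · 1#) (λ a → π a b) ⟩
          v b · 1# * sumOver S (λ a → π a b) ≈⟨ *-congˡ (sumOver-marginalʳ b) ⟩
          v b · 1# * ν b                     ≈⟨ ·-as-* (v b) (ν b) ⟨
          v b · ν b                          ∎
        Σˡ : ∀ a → sumOver S (λ b → - (u a · 1#) * π a b) ≈ - (u a · μ a)
        Σˡ a = begin
          sumOver S (λ b → - (u a · 1#) * π a b) ≈⟨ sumOver-*ˡ S (- (u a · 1#)) (π a) ⟩
          - (u a · 1#) * sumOver S (π a)         ≈⟨ *-congˡ (sumOver-marginalˡ a) ⟩
          - (u a · 1#) * μ a                     ≈⟨ -‿distribˡ-* _ _ ⟨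
          - (u a · 1# * μ a)                     ≈⟨ -‿cong (·-as-* (u a) (μ a)) ⟨
          - (u a · μ a)                          ∎

    -- Complementary slackness: a coupling that charges only pairs at which the
    -- potentials are tight is optimal.
    W₁-potential : (u v : U → ℕ) →
      (∀ a b → ¬ μ a ≈ 0# → ¬ ν b ≈ 0# → v b ℕ.≤ dist G a b ℕ.+ u a) →
      ∀ {π} → IsCoupling G μ ν π →
      (∀ a b → ¬ π a b ≈ 0# → v b ≡ dist G a b ℕ.+ u a) →
      W₁ G μ ν ≈ sumOver S (λ b → v b · ν b) - sumOver S (λ a → u a · μ a)
    W₁-potential u v lipschitz {π} c tight =
      inf-min (π , c , sym (trans (cost≈sumOver c) (trans
          (sumOver-cong S (λ a → sumOver-cong S (λ b → attained a b)))
          (sumOver-potential c u v))))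
        λ { r (ρ , d , r≈cost) → ≤-respʳ-≈ (sym (trans r≈cost (cost≈sumOver d)))
          (≤-respˡ-≈ (sumOver-potential d u v)
            (sumOver-mono S (λ a → sumOver-mono S (λ b → bounded d a b)))) }
      where
      both-zero : ∀ a b {x} → x ≈ 0# → dist G a b · x ≈ (v b · 1# - u a · 1#) * x
      both-zero a b {x} x≈0 = begin
        dist G a b · x            ≈⟨ ·-as-* (dist G a b) x ⟩
        dist G a b · 1# * x       ≈⟨ trans (*-congˡ x≈0) (zeroʳ _) ⟩
        0#                        ≈⟨ trans (*-congˡ x≈0) (zeroʳ _) ⟨
        (v b · 1# - u a · 1#) * x ∎
      slack : ∀ a b → (dist G a b ℕ.+ u a) · 1# - u a · 1# ≈ dist G a b · 1#
      slack a b = trans (+-congʳ (×-homo-+ 1# (dist G a b) (u a)))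
        (solve 2 (λ d u → d :+ u :- u := d) refl (dist G a b · 1#) (u a · 1#))
      attained : ∀ a b → dist G a b · π a b ≈ (v b · 1# - u a · 1#) * π a b
      attained a b with em {π a b ≈ 0#}
      ... | yes π≈0 = both-zero a b π≈0
      ... | no π≉0  = trans (·-as-* (dist G a b) (π a b)) (*-congʳ (sym
        (≡.subst (λ n → n · 1# - u a · 1# ≈ dist G a b · 1#) (≡.sym (tight a b π≉0)) (slack a b))))
      bounded : ∀ {ρ} → IsCoupling G μ ν ρ → ∀ a b →
                (v b · 1# - u a · 1#) * ρ a b ≤ dist G a b · ρ a b
      bounded {ρ} d a b with em {μ a ≈ 0#} | em {ν b ≈ 0#}
      ... | yes μ≈0 | _       = ≤-reflexive (sym (both-zero a b (coupling-zeroˡ d μ≈0 b)))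
      ... | no _    | yes ν≈0 = ≤-reflexive (sym (both-zero a b (coupling-zeroʳ d ν≈0 a)))
      ... | no μ≉0  | no ν≉0  = ≤-respʳ-≈ (sym (·-as-* (dist G a b) (ρ a b)))
        (*-monoˡ-≤ (IsCoupling.nonNeg d a b) (≤-respʳ-≈ (slack a b)
          (+-mono-≤ (·1-mono (lipschitz a b μ≉0 ν≉0)) ≤-refl)))

    -- Keep the mass ν x in place and couple what is left independently.
    lazyCoupling : (∀ a → 0# ≤ μ a) → (∀ b → 0# ≤ ν b) →
      sumOver S μ ≈ 1# → sumOver S ν ≈ 1# →
      ∀ {x} → x ∈ S → ν x ≤ μ x → ν x < 1# →
      ∃[ π ] IsCoupling G μ ν π × (∀ a → ¬ a ≡ x → π a x ≈ 0#)
    lazyCoupling 0≤μ 0≤ν Σμ Σν {x} x∈S t≤μx t<1 =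
      π , coupling 0≤π π↾ˡ π↾ʳ Σˡ Σʳ , avoids
      where
      t s⁻¹ : ℝ
      t   = ν x
      s⁻¹ = (1# - t) ⁻¹

      0<s : 0# < 1# - t
      0<s = x<y⇒0<y-x t<1

      μ′ ν′ : U → ℝ
      μ′ a = μ a - t * δ x a
      ν′ b = ν b - t * δ x b

      -- Both residual measures have total mass `1 - t`; dividing their product by it gives a
      -- coupling of the residuals.
      π : U → U → ℝ
      π a b = t * (δ x a * δ x b) + μ′ a * ν′ b * s⁻¹

      -- The demand at `x` is met entirely by the mass kept in place, so the product part delivers
      -- nothing there.
      ν′x : ν′ x ≈ 0#
      ν′x = trans (+-congˡ (-‿cong (trans (*-congˡ (reflexive (δ-diag ≡.refl))) (*-identityʳ t))))
                  (-‿inverseʳ t)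

      residual-nonNeg : ∀ f → (∀ a → 0# ≤ f a) → t ≤ f x → ∀ a → 0# ≤ f a - t * δ x a
      residual-nonNeg f 0≤f t≤fx a with em {a ≡ x}
      ... | yes ≡.refl = x≤y⇒0≤y-x (≤-respˡ-≈ (sym (*-identityʳ t)) t≤fx)
      ... | no _       = ≤-respʳ-≈ (sym (trans (+-congˡ (trans (-‿cong (zeroʳ t)) -0#≈0#))
                                               (+-identityʳ _))) (0≤f a)

      0≤π : ∀ a b → 0# ≤ π a b
      0≤π a b = +-nonNeg (*-nonNeg (0≤ν x) (*-nonNeg (δ-nonNeg x a) (δ-nonNeg x b)))
        (*-nonNeg (*-nonNeg (residual-nonNeg μ 0≤μ t≤μx a) (residual-nonNeg ν 0≤ν ≤-refl b))
                  (<⇒≤ (⁻¹-pos 0<s)))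

      δ-∉ : ∀ {a} → a ∉ S → δ x a ≈ 0#
      δ-∉ a∉S = reflexive (δ-off λ { ≡.refl → a∉S x∈S })

      π↾ˡ : ∀ a → a ∉ S → ∀ b → π a b ≈ 0#
      π↾ˡ a a∉S b = trans
        (+-cong (*-congˡ (*-congʳ (δ-∉ a∉S)))
                (*-congʳ (*-congʳ (+-cong (μ↾S a a∉S) (-‿cong (*-congˡ (δ-∉ a∉S)))))))
        (solve 4 (λ t d n s → t :* (𝟎 :* d) :+ (𝟎 :- t :* 𝟎) :* n :* s := 𝟎) refl t (δ x b) (ν′ b) s⁻¹)

      π↾ʳ : ∀ b → b ∉ S → ∀ a → π a b ≈ 0#
      π↾ʳ b b∉S a = trans
        (+-cong (*-congˡ (*-congˡ (δ-∉ b∉S)))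
                (*-congʳ (*-congˡ (+-cong (ν↾S b b∉S) (-‿cong (*-congˡ (δ-∉ b∉S)))))))
        (solve 4 (λ t d m s → t :* (d :* 𝟎) :+ m :* (𝟎 :- t :* 𝟎) :* s := 𝟎) refl t (δ x a) (μ′ a) s⁻¹)

      -- Rows and columns of `π` both take this shape once the fixed coordinate is absorbed into `c`
      -- and `d`.
      Σ-affine : ∀ f c d → sumOver S f ≈ 1# →
        sumOver S (λ b → c * δ x b + d * (f b - t * δ x b)) ≈ c + d * (1# - t)
      Σ-affine f c d Σf = begin
        sumOver S (λ b → c * δ x b + d * (f b - t * δ x b))
          ≈⟨ sumOver-cong S (λ b → solve 5 (λ c e d f t →
               c :* e :+ d :* (f :- t :* e) := (c :- d :* t) :* e :+ d :* f) refl
               c (δ x b) d (f b) t) ⟩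
        sumOver S (λ b → (c - d * t) * δ x b + d * f b)
          ≈⟨ trans (sumOver-+ S _ _) (+-cong (sumOver-*ˡ S _ _) (sumOver-*ˡ S _ _)) ⟩
        (c - d * t) * sumOver S (δ x) + d * sumOver S f
          ≈⟨ +-cong (*-congˡ (sumOver-δ-1 uS x∈S)) (*-congˡ Σf) ⟩
        (c - d * t) * 1# + d * 1#
          ≈⟨ solve 3 (λ c d t → (c :- d :* t) :* 𝟏 :+ d :* 𝟏 := c :+ d :* (𝟏 :- t)) refl c d t ⟩
        c + d * (1# - t) ∎

      restore : ∀ e m → t * e + (m - t * e) * s⁻¹ * (1# - t) ≈ m
      restore e m = begin
        t * e + (m - t * e) * s⁻¹ * (1# - t)
          ≈⟨ solve 4 (λ e m t i → t :* e :+ (m :- t :* e) :* i :* (𝟏 :- t)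
               := t :* e :+ (m :- t :* e) :* ((𝟏 :- t) :* i)) refl e m t s⁻¹ ⟩
        t * e + (m - t * e) * ((1# - t) * s⁻¹)
          ≈⟨ +-congˡ (*-congˡ (x*x⁻¹≈1 0<s)) ⟩
        t * e + (m - t * e) * 1#
          ≈⟨ solve 3 (λ e m t → t :* e :+ (m :- t :* e) :* 𝟏 := m) refl e m t ⟩
        m ∎

      Σˡ : ∀ a → sumOver S (π a) ≈ μ a
      Σˡ a = begin
        sumOver S (π a)
          ≈⟨ sumOver-cong S (λ b → solve 6 (λ t d e m n i →
               t :* (d :* e) :+ m :* n :* i := t :* d :* e :+ m :* i :* n) refl
               t (δ x a) (δ x b) (μ′ a) (ν′ b) s⁻¹) ⟩
        sumOver S (λ b → t * δ x a * δ x b + μ′ a * s⁻¹ * ν′ b)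
          ≈⟨ Σ-affine ν (t * δ x a) (μ′ a * s⁻¹) Σν ⟩
        t * δ x a + μ′ a * s⁻¹ * (1# - t)
          ≈⟨ restore (δ x a) (μ a) ⟩
        μ a ∎

      Σʳ : ∀ b → sumOver S (λ a → π a b) ≈ ν b
      Σʳ b = begin
        sumOver S (λ a → π a b)
          ≈⟨ sumOver-cong S (λ a → solve 6 (λ t d e m n i →
               t :* (d :* e) :+ m :* n :* i := t :* e :* d :+ n :* i :* m) refl
               t (δ x a) (δ x b) (μ′ a) (ν′ b) s⁻¹) ⟩
        sumOver S (λ a → t * δ x b * δ x a + ν′ b * s⁻¹ * μ′ a)
          ≈⟨ Σ-affine μ (t * δ x b) (ν′ b * s⁻¹) Σμ ⟩
        t * δ x b + ν′ b * s⁻¹ * (1# - t)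
          ≈⟨ restore (δ x b) (ν b) ⟩
        ν b ∎

      avoids : ∀ a → ¬ a ≡ x → π a x ≈ 0#
      avoids a a≢x = trans
        (+-cong (*-congˡ (*-congʳ (reflexive (δ-off a≢x)))) (*-congʳ (*-congˡ ν′x)))
        (solve 4 (λ t d m i → t :* (𝟎 :* d) :+ m :* 𝟎 :* i := 𝟎) refl t (δ x x) (μ′ a) s⁻¹)

-- Graph distances around a tree-like edge.

-- The search bound inside `dist` is the length of an arbitrary walk supplied by excluded middle, so
-- the answer has to be the same for every large enough `b`.
least-≡ : {P : ℕ → Set} (P? : ∀ n → Dec (P n)) {b n : ℕ} →
          P n → (∀ {m} → m ℕ.< n → ¬ P m) → n ℕ.≤ b → least P? b ≡ n
least-≡ P? {zero}  {zero}  Pn below n≤b = ≡.refl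
least-≡ P? {suc b} {n}     Pn below n≤b with P? 0
least-≡ P? {suc b} {zero}  Pn below n≤b | yes _  = ≡.refl
least-≡ P? {suc b} {suc n} Pn below n≤b | yes P0 = contradiction P0 (below z<s)
least-≡ P? {suc b} {zero}  Pn below n≤b | no ¬P0 = contradiction Pn ¬P0
least-≡ P? {suc b} {suc n} Pn below n≤b | no _   =
  ≡.cong suc (least-≡ (P? ∘ suc) Pn (below ∘ s<s) (ℕ.s≤s⁻¹ n≤b))

module ShortCycles {U : Set} (K : Graph U) where
  open Graph K

  ∼⇒≢ : ∀ {x y} → x ∼ y → x ≢ y
  ∼⇒≢ x∼y ≡.refl = ∼-irrefl x∼y

  triangle : ∀ {x y z} → x ∼ y → y ∼ z → z ∼ x → LiesOnCycle K 3 x y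
  triangle {x} {y} {z} x∼y y∼z z∼x = record
    { vertex    = lookup (x ∷ y ∷ z ∷ [])
    ; injective = lookup-injective
        ((∼⇒≢ x∼y ∷ ∼⇒≢ (∼-sym z∼x) ∷ []) ∷ (∼⇒≢ y∼z ∷ []) ∷ [] ∷ []) _ _
    ; adjacent  = λ { 0F → x∼y ; 1F → y∼z ; 2F → z∼x }
    } , 0F , inj₁ (≡.refl , ≡.refl)

  -- Distinctness is asked of non-consecutive vertices only; along an edge it follows from
  -- irreflexivity.
  square : ∀ {x y z w} → x ∼ y → y ∼ z → z ∼ w → w ∼ x → x ≢ z → y ≢ w → LiesOnCycle K 4 x y
  square {x} {y} {z} {w} x∼y y∼z z∼w w∼x x≢z y≢w = record
    { vertex    = lookup (x ∷ y ∷ z ∷ w ∷ [])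
    ; injective = lookup-injective
        ((∼⇒≢ x∼y ∷ x≢z ∷ ∼⇒≢ (∼-sym w∼x) ∷ []) ∷ (∼⇒≢ y∼z ∷ y≢w ∷ []) ∷ (∼⇒≢ z∼w ∷ []) ∷ [] ∷ []) _ _
    ; adjacent  = λ { 0F → x∼y ; 1F → y∼z ; 2F → z∼w ; 3F → w∼x }
    } , 0F , inj₁ (≡.refl , ≡.refl)

  pentagon : ∀ {x y z v w} → x ∼ y → y ∼ z → z ∼ v → v ∼ w → w ∼ x →
             x ≢ z → x ≢ v → y ≢ v → y ≢ w → z ≢ w → LiesOnCycle K 5 x y
  pentagon {x} {y} {z} {v} {w} x∼y y∼z z∼v v∼w w∼x x≢z x≢v y≢v y≢w z≢w = record
    { vertex    = lookup (x ∷ y ∷ z ∷ v ∷ w ∷ [])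
    ; injective = lookup-injective
        ((∼⇒≢ x∼y ∷ x≢z ∷ x≢v ∷ ∼⇒≢ (∼-sym w∼x) ∷ []) ∷ (∼⇒≢ y∼z ∷ y≢v ∷ y≢w ∷ []) ∷
         (∼⇒≢ z∼v ∷ z≢w ∷ []) ∷ (∼⇒≢ v∼w ∷ []) ∷ [] ∷ []) _ _
    ; adjacent  = λ { 0F → x∼y ; 1F → y∼z ; 2F → z∼v ; 3F → v∼w ; 4F → w∼x }
    } , 0F , inj₁ (≡.refl , ≡.refl)

module _ {U : Set} {H G : Graph U} (H⊆G : H ⊆ᴳ G) where
  private
    module H = Graph H
    module G = Graph G
  open _⊆ᴳ_ H⊆G

  cycle-⊆ : ∀ n .{{_ : ℕ.NonZero n}} {x y} → LiesOnCycle H n x y → LiesOnCycle G n x y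
  cycle-⊆ n (c , i , on) = record { Cycle c ; adjacent = ∼-⊆ ∘ adjacent } , i , on
    where open Cycle c

  treeLike-⊆ : ∀ {x y} → x H.∼ y → TreeLike G x y → TreeLike H x y
  treeLike-⊆ x∼y t = record
    { edge = x∼y
    ; no-3 = no-3 ∘ cycle-⊆ 3
    ; no-4 = no-4 ∘ cycle-⊆ 4
    ; no-5 = no-5 ∘ cycle-⊆ 5
    }
    where open TreeLike t

module Distances (em : ExcludedMiddle 0ℓ) (ℛ : CompleteOrderedField) {U : Set} (K : Graph U) where
  open Curvature em ℛ
  open FiniteSums em ℛ using (if-yes; if-no)
  open Graph K
  open ShortCycles K

  dist-≡ : ∀ {x y n} → Walk K x y n → (∀ {m} → m ℕ.< n → ¬ Walk K x y m) → dist K x y ≡ n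
  dist-≡ {x} {y} {n} walk shortest with em {∃ (Walk K x y)}
  ... | yes (m , walk′) = least-≡ (λ _ → em) walk shortest
                            (ℕ.≮⇒≥ λ m<n → shortest m<n walk′)
  ... | no ¬walk        = contradiction (n , walk) ¬walk

  ∼-vertexʳ : ∀ {x y} → x ∼ y → V y
  ∼-vertexʳ = ∼-vertexˡ ∘ ∼-sym

  walk₁ : ∀ {x y} → x ∼ y → Walk K x y 1
  walk₁ x∼y = cons x∼y (nil (∼-vertexʳ x∼y))

  dist-0 : ∀ {x} → V x → dist K x x ≡ 0
  dist-0 x∈V = dist-≡ (nil x∈V) λ ()

  dist-1 : ∀ {x y} → x ∼ y → dist K x y ≡ 1
  dist-1 x∼y = dist-≡ (walk₁ x∼y) λ { z<s (nil _) → ∼-irrefl x∼y }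

  dist-2 : ∀ {x y z} → x ∼ y → y ∼ z → x ≢ z → ¬ x ∼ z → dist K x z ≡ 2
  dist-2 x∼y y∼z x≢z x≁z = dist-≡ (cons x∼y (walk₁ y∼z)) λ where
    z<s       (nil _)            → x≢z ≡.refl
    (s<s z<s) (cons x∼z (nil _)) → x≁z x∼z

  dist-3 : ∀ {x y z w} → x ∼ y → y ∼ z → z ∼ w →
    x ≢ w → ¬ x ∼ w → (∀ {v} → x ∼ v → ¬ v ∼ w) → dist K x w ≡ 3
  dist-3 x∼y y∼z z∼w x≢w x≁w no-path = dist-≡ (cons x∼y (cons y∼z (walk₁ z∼w))) λ where
    z<s             (nil _)                       → x≢w ≡.refl
    (s<s z<s)       (cons x∼w (nil _))            → x≁w x∼w
    (s<s (s<s z<s)) (cons x∼v (cons v∼w (nil _))) → no-path x∼v v∼w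

  module _ {x y : U} (t : TreeLike K x y) where
    open TreeLike t

    private
      x≢y : x ≢ y
      x≢y = ∼⇒≢ edge

      x≁ : ∀ {b} → y ∼ b → ¬ x ∼ b
      x≁ y∼b x∼b = no-3 (triangle edge y∼b (∼-sym x∼b))

    -- Any shorter walk closes up through `x` and `y`: `a ≡ b` gives a triangle, `a ∼ b` a square,
    -- and a common neighbour `v` a pentagon, or already a triangle if `v` is `x` or `y`.
    dist-across : ∀ {a b} → x ∼ a → y ∼ b → a ≢ y → b ≢ x → dist K a b ≡ 3
    dist-across {a} {b} x∼a y∼b a≢y b≢x = dist-3 (∼-sym x∼a) edge y∼b a≢b a≁b no-path
      where
      a≢b : a ≢ b
      a≢b ≡.refl = x≁ y∼b x∼a
      a≁b : ¬ a ∼ b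
      a≁b a∼b = no-4 (square edge y∼b (∼-sym a∼b) (∼-sym x∼a) (b≢x ∘ ≡.sym) (a≢y ∘ ≡.sym))
      no-path : ∀ {v} → a ∼ v → ¬ v ∼ b
      no-path {v} a∼v v∼b = no-5 (pentagon edge y∼b (∼-sym v∼b) (∼-sym a∼v) (∼-sym x∼a)
        (b≢x ∘ ≡.sym) (λ { ≡.refl → x≁ y∼b v∼b }) (λ { ≡.refl → x≁ (∼-sym a∼v) x∼a })
        (a≢y ∘ ≡.sym) (a≢b ∘ ≡.sym))

    -- The potentials come from a single 1-Lipschitz function with values 0, 1, 2
    -- and 3 on x's other neighbours, x, y and y's other neighbours.
    left right : U → ℕ
    left  a = if does (em {a ≡ x}) then 1 else if does (em {a ≡ y}) then 2 else 0
    right b = if does (em {b ≡ x}) then 1 else if does (em {b ≡ y}) then 2 else 3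

    left-x : left x ≡ 1
    left-x = if-yes ≡.refl

    left-y : left y ≡ 2
    left-y = ≡.trans (if-no (x≢y ∘ ≡.sym)) (if-yes ≡.refl)

    left-other : ∀ {a} → a ≢ x → a ≢ y → left a ≡ 0
    left-other a≢x a≢y = ≡.trans (if-no a≢x) (if-no a≢y)

    right-x : right x ≡ 1
    right-x = if-yes ≡.refl

    right-y : right y ≡ 2
    right-y = ≡.trans (if-no (x≢y ∘ ≡.sym)) (if-yes ≡.refl)

    right-other : ∀ {b} → b ≢ x → b ≢ y → right b ≡ 3
    right-other b≢x b≢y = ≡.trans (if-no b≢x) (if-no b≢y)

    -- The potential rises by one at each step of a walk from a neighbour of `x` over `x` and `y` to
    -- a neighbour of `y`. Every pair is joined by a geodesic that is a piece of such a walk, except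
    -- that from `y` to `x` the edge is traversed downwards.
    potentials-tight : ∀ {a b} → a ≡ x ⊎ x ∼ a → b ≡ y ⊎ y ∼ b →
      right b ≡ dist K a b ℕ.+ left a ⊎ (a ≡ y × b ≡ x)
    potentials-tight {a} {b} near-x near-y = tight em em em em
      where
      shift : ∀ {m n r} {k : Set} → dist K a b ≡ m → left a ≡ n → right b ≡ r → r ≡ m ℕ.+ n →
              right b ≡ dist K a b ℕ.+ left a ⊎ k
      shift d≡ l≡ r≡ r≡m+n =
        inj₁ (≡.trans r≡ (≡.trans r≡m+n (≡.sym (≡.cong₂ ℕ._+_ d≡ l≡))))

      y∼ : b ≢ y → y ∼ b
      y∼ b≢y = [ (λ b≡y → contradiction b≡y b≢y) , (λ y∼b → y∼b) ]′ near-y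
      x∼ : a ≢ x → x ∼ a
      x∼ a≢x = [ (λ a≡x → contradiction a≡x a≢x) , (λ x∼a → x∼a) ]′ near-x

      tight : Dec (a ≡ x) → Dec (a ≡ y) → Dec (b ≡ x) → Dec (b ≡ y) →
              right b ≡ dist K a b ℕ.+ left a ⊎ (a ≡ y × b ≡ x)
      tight (yes ≡.refl) _ (yes ≡.refl) _ =
        shift (dist-0 (∼-vertexˡ edge)) left-x right-x ≡.refl
      tight (yes ≡.refl) _ (no _) (yes ≡.refl) =
        shift (dist-1 edge) left-x right-y ≡.refl
      tight (yes ≡.refl) _ (no b≢x) (no b≢y) =
        shift (dist-2 edge (y∼ b≢y) (b≢x ∘ ≡.sym) (x≁ (y∼ b≢y)))
          left-x (right-other b≢x b≢y) ≡.refl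
      tight (no _) (yes a≡y) (yes b≡x) _ = inj₂ (a≡y , b≡x)
      tight (no _) (yes ≡.refl) (no _) (yes ≡.refl) =
        shift (dist-0 (∼-vertexʳ edge)) left-y right-y ≡.refl
      tight (no _) (yes ≡.refl) (no b≢x) (no b≢y) =
        shift (dist-1 (y∼ b≢y)) left-y (right-other b≢x b≢y) ≡.refl
      tight (no a≢x) (no a≢y) (yes ≡.refl) _ =
        shift (dist-1 (∼-sym (x∼ a≢x))) (left-other a≢x a≢y) right-x ≡.refl
      tight (no a≢x) (no a≢y) (no _) (yes ≡.refl) =
        shift (dist-2 (∼-sym (x∼ a≢x)) edge a≢y (λ a∼y → x≁ (∼-sym a∼y) (x∼ a≢x)))
          (left-other a≢x a≢y) right-y ≡.refl
      tight (no a≢x) (no a≢y) (no b≢x) (no b≢y) =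
        shift (dist-across (x∼ a≢x) (y∼ b≢y) a≢y b≢x)
          (left-other a≢x a≢y) (right-other b≢x b≢y) ≡.refl

    -- At the exceptional pair there is room to spare, since 1 ≤ 2 before any distance is added. The
    -- restriction to points near the edge matters: at a vertex `a` other than `x` and `y`, taking
    -- `b` equal to `a` would demand 3 ≤ 0.
    potentials-lipschitz : ∀ {a b} → a ≡ x ⊎ x ∼ a → b ≡ y ⊎ y ∼ b →
      right b ℕ.≤ dist K a b ℕ.+ left a
    potentials-lipschitz {a} {b} near-x near-y with potentials-tight near-x near-y
    ... | inj₁ tight             = ℕ.≤-reflexive tight
    ... | inj₂ (≡.refl , ≡.refl) =
      ℕ.≤-trans (ℕ.≤-reflexive right-x) (ℕ.≤-trans (s≤s z≤n)
        (ℕ.≤-trans (ℕ.≤-reflexive (≡.sym left-y)) (ℕ.m≤n+m _ (dist K y x))))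

-- The exact curvature of a tree-like edge.

module TreeLikeCurvature (em : ExcludedMiddle 0ℓ) (ℛ : CompleteOrderedField) {U : Set} where

  open Curvature em ℛ
  open CompleteOrderedField ℛ renaming (Carrier to ℝ)
  open OrderedField ℛ
  open FiniteSums em ℛ
  open Transport em ℛ
  open import Algebra.Properties.Semiring.Mult semiring using () renaming (_×_ to _·_)
  open import Relation.Binary.Reasoning.Setoid setoid

  -- Weaker than local finiteness at x, so that it passes to subgraphs.
  NeighboursIn : Graph U → List U → U → Set
  NeighboursIn K l x = ∀ {z} → Graph._∼_ K x z → z ∈ l

  module _ (K : Graph U) (𝓌 : Weight K) where
    open Graph K
    open Weight 𝓌
    open ShortCycles K using (∼⇒≢)

    edgeWeight : U → U → ℝ
    edgeWeight x z = if does (em {x ∼ z}) then w x z else 0#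

    edgeWeight-nonNeg : ∀ x z → 0# ≤ edgeWeight x z
    edgeWeight-nonNeg x z with em {x ∼ z}
    ... | yes x∼z = <⇒≤ (positive x∼z)
    ... | no _    = ≤-refl

    -- The transition probability of the weighted random walk along an edge.
    share : U → U → ℝ
    share x y = w x y * degree K 𝓌 x ⁻¹

    module _ {S : List U} (uS : Unique S) {x : U} (x∼⊆S : NeighboursIn K S x) where

      degree≈sumOver : degree K 𝓌 x ≈ sumOver S (edgeWeight x)
      degree≈sumOver = ∑≈sumOver uS λ z z∉S → reflexive (if-no (z∉S ∘ x∼⊆S))

      w≤degree : ∀ {y} → x ∼ y → w x y ≤ degree K 𝓌 x
      w≤degree {y} x∼y = ≤-respˡ-≈ (reflexive (if-yes x∼y)) (≤-respʳ-≈ (sym degree≈sumOver)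
        (term≤sumOver S (edgeWeight-nonNeg x) (x∼⊆S x∼y)))

      degree-pos : ∀ {y} → x ∼ y → 0# < degree K 𝓌 x
      degree-pos x∼y = <-≤-trans (positive x∼y) (w≤degree x∼y)

      share≤1 : ∀ {y} → x ∼ y → share x y ≤ 1#
      share≤1 x∼y = ≤-respʳ-≈ (x*x⁻¹≈1 (degree-pos x∼y))
        (*-monoˡ-≤ (<⇒≤ (⁻¹-pos (degree-pos x∼y))) (w≤degree x∼y))

      module _ (α : ℝ) where

        private
          μ : U → ℝ
          μ = measure K 𝓌 α x

        measure-self : μ x ≈ α
        measure-self = reflexive (if-yes ≡.refl)

        measure-neighbour : ∀ {y} → x ∼ y → μ y ≈ (1# - α) * share x y
        measure-neighbour x∼y = trans
          (reflexive (≡.trans (if-no (∼⇒≢ x∼y ∘ ≡.sym)) (if-yes x∼y))) (*-assoc _ _ _)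

        measure-support : ∀ a → ¬ μ a ≈ 0# → a ≡ x ⊎ x ∼ a
        measure-support a μa≉0 with em {a ≡ x} | em {x ∼ a}
        ... | yes a≡x | _       = inj₁ a≡x
        ... | no _    | yes x∼a = inj₂ x∼a
        ... | no _    | no _    = contradiction refl μa≉0

        measure-supportedOn : x ∈ S → SupportedOn S μ
        measure-supportedOn x∈S a a∉S = reflexive
          (≡.trans (if-no λ { ≡.refl → a∉S x∈S }) (if-no (a∉S ∘ x∼⊆S)))

        measure-nonNeg : 0# ≤ α → α ≤ 1# → ∀ a → 0# ≤ μ a
        measure-nonNeg 0≤α α≤1 a with em {a ≡ x} | em {x ∼ a}
        ... | yes _ | _       = 0≤α
        ... | no _  | no _    = ≤-refl
        ... | no _  | yes x∼a = *-nonNeg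
          (*-nonNeg (x≤y⇒0≤y-x α≤1) (<⇒≤ (positive x∼a))) (<⇒≤ (⁻¹-pos (degree-pos x∼a)))

        -- The neighbour `y` makes the degree positive; an isolated vertex would carry total mass
        -- `α` only.
        measure-total : x ∈ S → ∀ {y} → x ∼ y → sumOver S μ ≈ 1#
        measure-total x∈S x∼y = begin
          sumOver S μ
            ≈⟨ sumOver-cong S split ⟩
          sumOver S (λ a → α * δ x a + (1# - α) * d⁻¹ * edgeWeight x a)
            ≈⟨ trans (sumOver-+ S _ _) (+-cong (sumOver-*ˡ S _ _) (sumOver-*ˡ S _ _)) ⟩
          α * sumOver S (δ x) + (1# - α) * d⁻¹ * sumOver S (edgeWeight x)
            ≈⟨ +-cong (*-congˡ (sumOver-δ-1 uS x∈S)) (*-congˡ (sym degree≈sumOver)) ⟩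
          α * 1# + (1# - α) * d⁻¹ * degree K 𝓌 x
            ≈⟨ solve 3 (λ a i d → a :* 𝟏 :+ (𝟏 :- a) :* i :* d := a :+ (𝟏 :- a) :* (d :* i))
                 refl α d⁻¹ (degree K 𝓌 x) ⟩
          α + (1# - α) * (degree K 𝓌 x * d⁻¹)
            ≈⟨ +-congˡ (*-congˡ (x*x⁻¹≈1 (degree-pos x∼y))) ⟩
          α + (1# - α) * 1#
            ≈⟨ solve 1 (λ a → a :+ (𝟏 :- a) :* 𝟏 := 𝟏) refl α ⟩
          1# ∎
          where
          d⁻¹ : ℝ
          d⁻¹ = degree K 𝓌 x ⁻¹
          split : ∀ a → μ a ≈ α * δ x a + (1# - α) * d⁻¹ * edgeWeight x a
          split a with em {a ≡ x} | em {x ∼ a}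
          ... | yes ≡.refl | yes x∼x = contradiction x∼x ∼-irrefl
          ... | yes _      | no _    =
            solve 2 (λ a c → a := a :* 𝟏 :+ c :* 𝟎) refl α ((1# - α) * d⁻¹)
          ... | no _       | yes _   =
            solve 4 (λ a i w d → i :* w :* d := a :* 𝟎 :+ i :* d :* w) refl α (1# - α) (w x a) d⁻¹
          ... | no _       | no _    =
            solve 2 (λ a c → 𝟎 := a :* 𝟎 :+ c :* 𝟎) refl α ((1# - α) * d⁻¹)

    module _ {x y : U} (t : TreeLike K x y) {S : List U} (uS : Unique S)
             (x∼⊆S : NeighboursIn K S x) (y∼⊆S : NeighboursIn K S y) where
      open TreeLike t
      open Distances em ℛ K using (left; right; potentials-tight; potentials-lipschitz)

      treeLikeCurvature : ℝ
      treeLikeCurvature = 2# * (share x y + share y x) - 2#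

      private
        x≢y : x ≢ y
        x≢y = ∼⇒≢ edge

        x∈S : x ∈ S
        x∈S = y∼⊆S (∼-sym edge)

        y∈S : y ∈ S
        y∈S = x∼⊆S edge

        sumOver-left : ∀ f → sumOver S (λ a → left t a · f a) ≈ f x + 2# * f y
        sumOver-left f = begin
          sumOver S (λ a → left t a · f a)
            ≈⟨ sumOver-cong S split ⟩
          sumOver S (λ a → δ x a * f a + 2# * (δ y a * f a))
            ≈⟨ trans (sumOver-+ S _ _) (+-congˡ (sumOver-*ˡ S _ _)) ⟩
          sumOver S (λ a → δ x a * f a) + 2# * sumOver S (λ a → δ y a * f a)
            ≈⟨ +-cong (sumOver-δ uS x∈S f) (*-congˡ (sumOver-δ uS y∈S f)) ⟩
          f x + 2# * f y ∎
          where
          split : ∀ a → left t a · f a ≈ δ x a * f a + 2# * (δ y a * f a)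
          split a with em {a ≡ x} | em {a ≡ y}
          ... | yes ≡.refl | yes a≡y = contradiction a≡y x≢y
          ... | yes _      | no _    =
            solve 1 (λ f → f :+ 𝟎 := 𝟏 :* f :+ 𝟐 :* (𝟎 :* f)) refl (f a)
          ... | no _       | yes _   =
            solve 1 (λ f → f :+ (f :+ 𝟎) := 𝟎 :* f :+ 𝟐 :* (𝟏 :* f)) refl (f a)
          ... | no _       | no _    =
            solve 1 (λ f → 𝟎 := 𝟎 :* f :+ 𝟐 :* (𝟎 :* f)) refl (f a)

        -- Since `right` equals 3 minus twice `δ x` minus `δ y`, the total mass accounts for all
        -- other neighbours at once, and only the values at `x` and `y` survive in the curvature.
        sumOver-right : ∀ f → sumOver S f ≈ 1# →
                        sumOver S (λ b → right t b · f b) ≈ 2# + 1# - (2# * f x + f y)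
        sumOver-right f Σf = begin
          sumOver S (λ b → right t b · f b)
            ≈⟨ sumOver-cong S split ⟩
          sumOver S (λ b → (2# + 1#) * f b - (2# * (δ x b * f b) + δ y b * f b))
            ≈⟨ trans (sumOver-+ S _ _) (+-cong (sumOver-*ˡ S _ _) (trans (sumOver-neg S _)
                 (-‿cong (trans (sumOver-+ S _ _) (+-congʳ (sumOver-*ˡ S _ _)))))) ⟩
          (2# + 1#) * sumOver S f
            - (2# * sumOver S (λ b → δ x b * f b) + sumOver S (λ b → δ y b * f b))
            ≈⟨ +-cong (trans (*-congˡ Σf) (*-identityʳ _))
                 (-‿cong (+-cong (*-congˡ (sumOver-δ uS x∈S f)) (sumOver-δ uS y∈S f))) ⟩
          2# + 1# - (2# * f x + f y) ∎
          where
          split : ∀ b → right t b · f b ≈ (2# + 1#) * f b - (2# * (δ x b * f b) + δ y b * f b)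
          split b with em {b ≡ x} | em {b ≡ y}
          ... | yes ≡.refl | yes b≡y = contradiction b≡y x≢y
          ... | yes _      | no _    =
            solve 1 (λ f → f :+ 𝟎 := (𝟐 :+ 𝟏) :* f :- (𝟐 :* (𝟏 :* f) :+ 𝟎 :* f)) refl (f b)
          ... | no _       | yes _   =
            solve 1 (λ f → f :+ (f :+ 𝟎) := (𝟐 :+ 𝟏) :* f :- (𝟐 :* (𝟎 :* f) :+ 𝟏 :* f)) refl (f b)
          ... | no _       | no _    =
            solve 1 (λ f → f :+ (f :+ (f :+ 𝟎)) := (𝟐 :+ 𝟏) :* f :- (𝟐 :* (𝟎 :* f) :+ 𝟎 :* f))
              refl (f b)

      κ-treeLike : ∀ {α} → ½ < α → α < 1# → κ K 𝓌 α x y ≈ (1# - α) * treeLikeCurvature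
      κ-treeLike {α} ½<α α<1 = begin
        1# - W₁ K μ ν
          ≈⟨ +-congˡ (-‿cong (trans
               (W₁-potential K uS μ↾S ν↾S (left t) (right t) lipschitz isCoupling tight)
               (+-cong (sumOver-right ν Σν) (-‿cong (sumOver-left μ))))) ⟩
        1# - (2# + 1# - (2# * ν x + ν y) - (μ x + 2# * μ y))
          ≈⟨ +-congˡ (-‿cong (+-cong
               (+-congˡ (-‿cong (+-cong (*-congˡ νx) (measure-self uS y∼⊆S α))))
               (-‿cong (+-cong (measure-self uS x∼⊆S α) (*-congˡ (measure-neighbour uS x∼⊆S α edge)))))) ⟩
        1# - (2# + 1# - (2# * ((1# - α) * q) + α) - (α + 2# * ((1# - α) * p)))
          ≈⟨ collect α p q ⟩
        (1# - α) * treeLikeCurvature ∎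
        where
        collect : ∀ a p q →
          1# - (2# + 1# - (2# * ((1# - a) * q) + a) - (a + 2# * ((1# - a) * p)))
            ≈ (1# - a) * (2# * (p + q) - 2#)
        collect = solve 3 (λ a p q →
          𝟏 :- (𝟐 :+ 𝟏 :- (𝟐 :* ((𝟏 :- a) :* q) :+ a) :- (a :+ 𝟐 :* ((𝟏 :- a) :* p)))
            := (𝟏 :- a) :* (𝟐 :* (p :+ q) :- 𝟐)) refl

        μ ν : U → ℝ
        μ = measure K 𝓌 α x
        ν = measure K 𝓌 α y

        p q : ℝ
        p = share x y
        q = share y x

        0≤α : 0# ≤ α
        0≤α = ≤-trans (<⇒≤ 0<½) (<⇒≤ ½<α)

        μ↾S : SupportedOn S μ
        μ↾S = measure-supportedOn uS x∼⊆S α x∈S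

        ν↾S : SupportedOn S ν
        ν↾S = measure-supportedOn uS y∼⊆S α y∈S

        Σν : sumOver S ν ≈ 1#
        Σν = measure-total uS y∼⊆S α y∈S (∼-sym edge)

        νx : ν x ≈ (1# - α) * q
        νx = measure-neighbour uS y∼⊆S α (∼-sym edge)

        νx≤1-α : ν x ≤ 1# - α
        νx≤1-α = ≤-respˡ-≈ (sym νx) (≤-respʳ-≈ (*-identityʳ _)
          (*-monoʳ-≤ (<⇒≤ (x<y⇒0<y-x α<1)) (share≤1 uS y∼⊆S (∼-sym edge))))

        -- Together with the bound on `ν x` this puts the demand at `x` below the mass `α` that `μ`
        -- has there, as the lazy coupling requires.
        1-α<α : 1# - α < α
        1-α<α = y-x>0⇒x<y (+-pos-nonNeg (x<y⇒0<y-x ½<α) (<⇒≤ (x<y⇒0<y-x ½<α))) (begin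
          α - ½ + (α - ½)  ≈⟨ solve 2 (λ a h → a :- h :+ (a :- h) := a :+ a :- (h :+ h)) refl α ½ ⟩
          α + α - (½ + ½)  ≈⟨ +-congˡ (-‿cong ½+½≈1) ⟩
          α + α - 1#       ≈⟨ solve 1 (λ a → a :+ a :- 𝟏 := a :- (𝟏 :- a)) refl α ⟩
          α - (1# - α)     ∎)

        νx<α : ν x < α
        νx<α = ≤-<-trans νx≤1-α 1-α<α

        lazy : ∃[ π ] IsCoupling K μ ν π × (∀ a → ¬ a ≡ x → π a x ≈ 0#)
        lazy = lazyCoupling K uS μ↾S ν↾S
          (measure-nonNeg uS x∼⊆S α 0≤α (<⇒≤ α<1)) (measure-nonNeg uS y∼⊆S α 0≤α (<⇒≤ α<1))
          (measure-total uS x∼⊆S α x∈S edge) Σν x∈S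
          (≤-respʳ-≈ (sym (measure-self uS x∼⊆S α)) (<⇒≤ νx<α)) (<-≤-trans νx<α (<⇒≤ α<1))

        isCoupling : IsCoupling K μ ν (proj₁ lazy)
        isCoupling = proj₁ (proj₂ lazy)

        near-x : ∀ {a} → ¬ μ a ≈ 0# → a ≡ x ⊎ x ∼ a
        near-x = measure-support uS x∼⊆S α _

        near-y : ∀ {b} → ¬ ν b ≈ 0# → b ≡ y ⊎ y ∼ b
        near-y = measure-support uS y∼⊆S α _

        lipschitz : ∀ a b → ¬ μ a ≈ 0# → ¬ ν b ≈ 0# → right t b ℕ.≤ dist K a b ℕ.+ left t a
        lipschitz a b μa≉0 νb≉0 = potentials-lipschitz t (near-x μa≉0) (near-y νb≉0)

        tight : ∀ a b → ¬ proj₁ lazy a b ≈ 0# → right t b ≡ dist K a b ℕ.+ left t a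
        -- A charged pair lies in both supports, so it is tight or equal to `(y , x)`; the latter is
        -- impossible because the lazy coupling moves nothing into `x`.
        tight a b π≉0 = [ (λ eq → eq) , (λ (a≡y , b≡x) → contradiction (untight a≡y b≡x) π≉0) ]′
          (potentials-tight t
            (near-x λ μ≈0 → π≉0 (coupling-zeroˡ K uS μ↾S ν↾S isCoupling μ≈0 b))
            (near-y λ ν≈0 → π≉0 (coupling-zeroʳ K uS μ↾S ν↾S isCoupling ν≈0 a)))
          where
          untight : a ≡ y → b ≡ x → proj₁ lazy a b ≈ 0#
          untight ≡.refl ≡.refl = proj₂ (proj₂ lazy) y (x≢y ∘ ≡.sym)

      κ-quotient : ∀ {α} → ½ < α → α < 1# → κ K 𝓌 α x y * (1# - α) ⁻¹ ≈ treeLikeCurvature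
      κ-quotient {α} ½<α α<1 = begin
        κ K 𝓌 α x y * (1# - α) ⁻¹
          ≈⟨ *-congʳ (κ-treeLike ½<α α<1) ⟩
        (1# - α) * treeLikeCurvature * (1# - α) ⁻¹
          ≈⟨ solve 3 (λ s c i → s :* c :* i := s :* i :* c) refl (1# - α) treeLikeCurvature _ ⟩
        (1# - α) * (1# - α) ⁻¹ * treeLikeCurvature
          ≈⟨ *-congʳ (x*x⁻¹≈1 (x<y⇒0<y-x α<1)) ⟩
        1# * treeLikeCurvature
          ≈⟨ *-identityˡ _ ⟩
        treeLikeCurvature ∎

-- Limits, distortion and restriction to a subgraph.

module Monotonicity (em : ExcludedMiddle 0ℓ) (ℛ : CompleteOrderedField) where

  open Curvature em ℛ
  open CompleteOrderedField ℛ renaming (Carrier to ℝ)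
  open OrderedField ℛ
  open FiniteSums em ℛ
  open Transport em ℛ
  open TreeLikeCurvature em ℛ
  open AddSupremum _≤_ using ([_]; _≤⊤⁺)
  open import Relation.Binary.Reasoning.Setoid setoid

  1-½≈½ : 1# - ½ ≈ ½
  1-½≈½ = trans (+-congʳ (sym ½+½≈1)) (solve 1 (λ h → h :+ h :- h := h) refl ½)

  leftLimit-eventuallyConstant : ∀ {f c} → (∀ {α} → ½ < α → α < 1# → f α ≈ c) → LeftLimitAt1 f c
  leftLimit-eventuallyConstant {f} {c} f≈c ε 0<ε = ½ , 0<½ , λ α _ 1-½<α α<1 →
    let f≈c′ = sym (f≈c (<-respˡ-≈ 1-½≈½ 1-½<α) α<1) in
    <-respʳ-≈ f≈c′ (y-x>0⇒x<y 0<ε (solve 2 (λ c e → e := c :- (c :- e)) refl c ε)) ,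
    <-respˡ-≈ f≈c′ (y-x>0⇒x<y 0<ε (solve 2 (λ c e → e := c :+ e :- c) refl c ε))

  near-1 : ∀ {δ} → 0# < δ → ∃[ α ] 1# - δ < α × ½ < α × α < 1#
  -- Here `m` is the minimum of `δ` and `½`; halving it makes both lower bounds on `α` strict.
  near-1 {δ} 0<δ = 1# - ½ * m ,
    y-x>0⇒x<y (+-pos-nonNeg 0<½m (x≤y⇒0≤y-x m≤δ)) (halve δ refl) ,
    y-x>0⇒x<y (+-pos-nonNeg 0<½m (x≤y⇒0≤y-x m≤½)) (halve ½ (sym 1-½≈½)) ,
    y-x>0⇒x<y 0<½m (solve 1 (λ k → k := 𝟏 :- (𝟏 :- k)) refl (½ * m))
    where
    minimum : ∃[ m ] 0# < m × m ≤ δ × m ≤ ½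
    minimum = [ (λ δ≤½ → δ , 0<δ , ≤-refl , δ≤½) , (λ ½≤δ → ½ , 0<½ , ½≤δ , ≤-refl) ]′ (total δ ½)
    m : ℝ
    m = proj₁ minimum
    0<½m : 0# < ½ * m
    0<½m = *-pos 0<½ (proj₁ (proj₂ minimum))
    m≤δ : m ≤ δ
    m≤δ = proj₁ (proj₂ (proj₂ minimum))
    m≤½ : m ≤ ½
    m≤½ = proj₂ (proj₂ (proj₂ minimum))
    -- The separate `e` allows `½` to stand for `1 - ½` when `d` is `½`.
    halve : ∀ d {e} → e ≈ 1# - d → ½ * m + (d - m) ≈ 1# - ½ * m - e
    halve d {e} e≈1-d = begin
      ½ * m + (d - m)                ≈⟨ +-congˡ (+-congˡ (-‿cong (trans (*-congʳ ½+½≈1) (*-identityˡ m)))) ⟨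
      ½ * m + (d - (½ + ½) * m)      ≈⟨ solve 3 (λ h m d →
        h :* m :+ (d :- (h :+ h) :* m) := 𝟏 :- h :* m :- (𝟏 :- d)) refl ½ m d ⟩
      1# - ½ * m - (1# - d)          ≈⟨ +-congˡ (-‿cong e≈1-d) ⟨
      1# - ½ * m - e                 ∎

  -- If `c` were negative, `ε = - c` would be an admissible tolerance, and one `α` close to 1 with
  -- `f α ≈ c` would give `L + c < c`, so `L` would be negative.
  leftLimit-nonNeg : ∀ {f c L} → (∀ {α} → ½ < α → α < 1# → f α ≈ c) →
                     LeftLimitAt1 f L → 0# ≤ L → 0# ≤ c
  leftLimit-nonNeg {f} {c} {L} f≈c f→L 0≤L with em {0# ≤ c}
  ... | yes 0≤c = 0≤c
  ... | no 0≰c  = contradiction 0≤L (<⇒≱ L<0)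
    where
    0<-c : 0# < - c
    0<-c = y-x>0⇒x<y (x<y⇒0<y-x (≰⇒> 0≰c)) (solve 1 (λ c → 𝟎 :- c := :- c :- 𝟎) refl c)
    L<0 : L < 0#
    L<0 =
      let (δ , 0<δ , close)         = f→L (- c) 0<-c
          (α , 1-δ<α , ½<α , α<1)   = near-1 0<δ
          0≤α                       = <⇒≤ (≤-<-trans (<⇒≤ 0<½) ½<α)
          (L+c<fα , _)              = close α 0≤α 1-δ<α α<1
      in y-x>0⇒x<y (x<y⇒0<y-x (<-respʳ-≈ (f≈c ½<α α<1) L+c<fα))
           (solve 2 (λ c L → c :- (L :- :- c) := 𝟎 :- L) refl c L)

  inf⁺-greatest : ∀ {P c} → (∀ r → P [ r ] → c ≤ r) → [ c ] ≤⁺ inf⁺ P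
  inf⁺-greatest {P} {c} c≤P with em {∃[ r ] P [ r ]}
  ... | yes inhabited = [ proj₂ (inf-isInf inhabited (c , c≤P)) c c≤P ]
  ... | no _          = _ ≤⊤⁺

  inf⁺-antimono : ∀ {P Q} → ∃ (LowerBound (λ r → Q [ r ])) →
    (∀ r → P [ r ] → ∃[ s ] Q [ s ] × s ≤ r) → inf⁺ Q ≤⁺ inf⁺ P
  inf⁺-antimono {P} {Q} (b , b≤Q) P⇒Q with em {∃[ r ] P [ r ]} | em {∃[ r ] Q [ r ]}
  ... | no _          | _           = _ ≤⊤⁺
  ... | yes (r , Pr)  | no empty    = contradiction (proj₁ (P⇒Q r Pr) , proj₁ (proj₂ (P⇒Q r Pr))) empty
  ... | yes (r₀ , P₀) | yes inhabited = [ proj₂ (inf-isInf (r₀ , P₀) (b , b≤P)) _ inf≤P ]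
    where
    inf≤P : LowerBound (λ r → P [ r ]) (inf (λ r → Q [ r ]))
    inf≤P r Pr with P⇒Q r Pr
    ... | s , Qs , s≤r = ≤-trans (proj₁ (inf-isInf inhabited (b , b≤Q)) s Qs) s≤r
    b≤P : LowerBound (λ r → P [ r ]) b
    b≤P r Pr with P⇒Q r Pr
    ... | s , Qs , s≤r = ≤-trans (b≤Q s Qs) s≤r

  module _ {U : Set} (K : Graph U) (𝓌 : Weight K) where
    open Weight 𝓌

    private
      Values : ℝ → Set
      Values = EdgeValue K 𝓌

    edgeValue-nonNeg : LowerBound Values 0#
    edgeValue-nonNeg r (x , y , x∼y , r≈w) = ≤-respʳ-≈ (sym r≈w) (<⇒≤ (positive x∼y))

    edgeValue-inhabited : HasEdge K → ∃ Values
    edgeValue-inhabited (x , y , x∼y) = w x y , x , y , x∼y , refl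

    Dist-bounded : ∃ (UpperBound Values) → 0# < inf Values →
                   Dist K 𝓌 ≡ [ sup Values * inf Values ⁻¹ ]
    Dist-bounded bounded 0<inf with em {∃ (UpperBound Values) × 0# < inf Values}
    ... | yes _    = ≡.refl
    ... | no ¬both = contradiction (bounded , 0<inf) ¬both

    Dist-finite : ∀ {r} → [ r ] ≡ Dist K 𝓌 →
      ∃ (UpperBound Values) × 0# < inf Values × r ≡ sup Values * inf Values ⁻¹
    Dist-finite eq with em {∃ (UpperBound Values) × 0# < inf Values}
    Dist-finite ≡.refl | yes (bounded , 0<inf) = bounded , 0<inf , ≡.refl

    -- This serves twice: as the lower bound that makes infima of distortions genuine, and for
    -- comparing with an edgeless `H`, whose value is 1.
    1≤Dist : HasEdge K → ∀ {r} → [ r ] ≡ Dist K 𝓌 → 1# ≤ r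
    1≤Dist e eq with Dist-finite eq
    ... | bounded , 0<inf , ≡.refl with edgeValue-inhabited e
    ... | v , Vv = ≤-respˡ-≈ (x*x⁻¹≈1 0<inf) (*-monoˡ-≤ (<⇒≤ (⁻¹-pos 0<inf)) inf≤sup)
      where
      inf≤sup : inf Values ≤ sup Values
      inf≤sup = ≤-trans (proj₁ (inf-isInf (v , Vv) (0# , edgeValue-nonNeg)) v Vv)
                        (proj₁ (sup-isSup (v , Vv) bounded) v Vv)

  DistOfAdmissible : {U : Set} → Graph U → ℝ ⁺ → Set
  DistOfAdmissible K D = ∃[ 𝓌 ] Admissible K 𝓌 × D ≡ Dist K 𝓌

  DN-LLY-edge : {U : Set} (K : Graph U) → HasEdge K → DN-LLY K ≡ inf⁺ (DistOfAdmissible K)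
  DN-LLY-edge K e with em {HasEdge K}
  ... | yes _ = ≡.refl
  ... | no ¬e = contradiction e ¬e

  DN-LLY-edgeless : {U : Set} (K : Graph U) → ¬ HasEdge K → DN-LLY K ≡ [ 1# ]
  DN-LLY-edgeless K ¬e with em {HasEdge K}
  ... | yes e = contradiction e ¬e
  ... | no _  = ≡.refl

  1≤DN-LLY : {U : Set} (K : Graph U) → [ 1# ] ≤⁺ DN-LLY K
  1≤DN-LLY K with em {HasEdge K}
  ... | yes e = inf⁺-greatest λ r (𝓌 , _ , eq) → 1≤Dist K 𝓌 e eq
  ... | no _  = [ ≤-refl ]

  module Restriction {U : Set} {H G : Graph U} (H⊆G : H ⊆ᴳ G) where
    private
      module H = Graph H
      module G = Graph G
    open _⊆ᴳ_ H⊆G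

    restrict : Weight G → Weight H
    restrict 𝓌 = record { w = w ; w-sym = w-sym ∘ ∼-⊆ ; positive = positive ∘ ∼-⊆ }
      where open Weight 𝓌

    hasEdge-⊆ : HasEdge H → HasEdge G
    hasEdge-⊆ (x , y , x∼y) = x , y , ∼-⊆ x∼y

    module _ (𝓌 : Weight G) where
      open Weight 𝓌

      edgeWeight-restrict : ∀ x z → edgeWeight H (restrict 𝓌) x z ≤ edgeWeight G 𝓌 x z
      edgeWeight-restrict x z with em {x H.∼ z} | em {x G.∼ z}
      ... | yes _   | yes _   = ≤-refl
      ... | yes x∼z | no x≁z  = contradiction (∼-⊆ x∼z) x≁z
      ... | no _    | yes x∼z = <⇒≤ (positive x∼z)
      ... | no _    | no _    = ≤-refl

      share-restrict : ∀ {S} → Unique S → ∀ {x y} → NeighboursIn G S x → x H.∼ y →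
                       share G 𝓌 x y ≤ share H (restrict 𝓌) x y
      share-restrict {S} uS x∼⊆S x∼y = *-monoʳ-≤ (<⇒≤ (positive (∼-⊆ x∼y)))
        (⁻¹-anti-≤ (degree-pos H (restrict 𝓌) uS (x∼⊆S ∘ ∼-⊆) x∼y)
          (≤-respˡ-≈ (sym (degree≈sumOver H (restrict 𝓌) uS (x∼⊆S ∘ ∼-⊆)))
            (≤-respʳ-≈ (sym (degree≈sumOver G 𝓌 uS x∼⊆S))
              (sumOver-mono S (edgeWeight-restrict _)))))

      admissible-restrict : LocallyFinite G → (∀ {x y} → x H.∼ y → TreeLike G x y) →
                            Admissible G 𝓌 → Admissible H (restrict 𝓌)
      admissible-restrict finite treeLike admissible x y x∼y =
        cᴴ , leftLimit-eventuallyConstant (κ-quotient H (restrict 𝓌) (treeLike-⊆ H⊆G x∼y tree)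
               uS (x∼⊆S ∘ ∼-⊆) (y∼⊆S ∘ ∼-⊆)) , ≤-trans 0≤cᴳ cᴳ≤cᴴ
        where
        tree : TreeLike G x y
        tree = treeLike x∼y

        nbrˣ = finite x (G.∼-vertexˡ (∼-⊆ x∼y))
        nbrʸ = finite y (G.∼-vertexˡ (G.∼-sym (∼-⊆ x∼y)))
        -- The list serves both graphs, since neighbours in `H` are neighbours in `G`. It contains
        -- `x` and `y` too, each being a neighbour of the other.
        support = distinct (proj₁ nbrˣ ++ proj₁ nbrʸ)

        S : List U
        S = proj₁ support

        uS : Unique S
        uS = proj₁ (proj₂ support)

        x∼⊆S : NeighboursIn G S x
        x∼⊆S = proj₂ (proj₂ support) ∘ ∈-++⁺ˡ ∘ Equivalence.from (proj₂ nbrˣ _)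

        y∼⊆S : NeighboursIn G S y
        y∼⊆S = proj₂ (proj₂ support) ∘ ∈-++⁺ʳ (proj₁ nbrˣ) ∘ Equivalence.from (proj₂ nbrʸ _)

        cᴳ cᴴ : ℝ
        cᴳ = treeLikeCurvature G 𝓌 tree uS x∼⊆S y∼⊆S
        cᴴ = treeLikeCurvature H (restrict 𝓌) (treeLike-⊆ H⊆G x∼y tree) uS (x∼⊆S ∘ ∼-⊆) (y∼⊆S ∘ ∼-⊆)

        0≤cᴳ : 0# ≤ cᴳ
        0≤cᴳ = let (L , κ→L , 0≤L) = admissible x y (∼-⊆ x∼y) in
          leftLimit-nonNeg (κ-quotient G 𝓌 tree uS x∼⊆S y∼⊆S) κ→L 0≤L

        cᴳ≤cᴴ : cᴳ ≤ cᴴ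
        cᴳ≤cᴴ = +-mono-≤ (*-monoʳ-≤ (<⇒≤ 0<2) (+-mono-≤
          (share-restrict uS x∼⊆S x∼y) (share-restrict uS y∼⊆S (H.∼-sym x∼y)))) ≤-refl

      Dist-restrict : HasEdge H → ∀ {r} → [ r ] ≡ Dist G 𝓌 →
                      ∃[ s ] [ s ] ≡ Dist H (restrict 𝓌) × s ≤ r
      Dist-restrict e eq with Dist-finite G 𝓌 eq
      ... | (b , bounded) , 0<infᴳ , ≡.refl =
        _ , ≡.sym (Dist-bounded H (restrict 𝓌) boundedᴴ (<-≤-trans 0<infᴳ infᴳ≤infᴴ)) ,
        -- The denominator is replaced first, with the supremum over `H` as a nonnegative factor,
        -- and then the numerator.
        ≤-trans (*-monoʳ-≤ 0≤supᴴ (⁻¹-anti-≤ 0<infᴳ infᴳ≤infᴴ))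
                (*-monoˡ-≤ (<⇒≤ (⁻¹-pos 0<infᴳ)) supᴴ≤supᴳ)
        where
        Valuesᴳ Valuesᴴ : ℝ → Set
        Valuesᴳ = EdgeValue G 𝓌
        Valuesᴴ = EdgeValue H (restrict 𝓌)

        values-⊆ : ∀ r → Valuesᴴ r → Valuesᴳ r
        values-⊆ r (x , y , x∼y , r≈w) = x , y , ∼-⊆ x∼y , r≈w

        boundedᴴ : ∃ (UpperBound Valuesᴴ)
        boundedᴴ = b , λ r → bounded r ∘ values-⊆ r

        inhabitedᴴ : ∃ Valuesᴴ
        inhabitedᴴ = edgeValue-inhabited H (restrict 𝓌) e

        inhabitedᴳ : ∃ Valuesᴳ
        inhabitedᴳ = edgeValue-inhabited G 𝓌 (hasEdge-⊆ e)

        isSupᴴ : IsSup Valuesᴴ (sup Valuesᴴ)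
        isSupᴴ = sup-isSup inhabitedᴴ boundedᴴ

        infᴳ≤infᴴ : inf Valuesᴳ ≤ inf Valuesᴴ
        infᴳ≤infᴴ = proj₂ (inf-isInf inhabitedᴴ (0# , edgeValue-nonNeg H (restrict 𝓌))) _
          λ r → proj₁ (inf-isInf inhabitedᴳ (0# , edgeValue-nonNeg G 𝓌)) r ∘ values-⊆ r

        supᴴ≤supᴳ : sup Valuesᴴ ≤ sup Valuesᴳ
        supᴴ≤supᴳ = proj₂ isSupᴴ _
          λ r → proj₁ (sup-isSup inhabitedᴳ (b , bounded)) r ∘ values-⊆ r

        0≤supᴴ : 0# ≤ sup Valuesᴴ
        0≤supᴴ = ≤-trans (edgeValue-nonNeg H (restrict 𝓌) _ (proj₂ inhabitedᴴ))
                         (proj₁ isSupᴴ _ (proj₂ inhabitedᴴ))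

theorem1p8 : (em : ExcludedMiddle 0ℓ) (ℛ : CompleteOrderedField) →
    let open Curvature em ℛ in
    {U : Set} (G : Graph U) → Connected G → LocallyFinite G →
    (H : Graph U) → H ⊆ᴳ G → Connected H →
    (∀ {x y} → Graph._∼_ H x y → TreeLike G x y) →
    DN-LLY H ≤⁺ DN-LLY G
theorem1p8 em ℛ G _ finite H H⊆G _ treeLike = cases em
  where
  open Curvature em ℛ
  open CompleteOrderedField ℛ using (1#)
  open Monotonicity em ℛ
  open Restriction H⊆G

  cases : Dec (HasEdge H) → DN-LLY H ≤⁺ DN-LLY G
  -- Here `H` is a single vertex with value 1 by convention, and no distortion is below 1.
  cases (no ¬e) = ≡.subst (_≤⁺ DN-LLY G) (≡.sym (DN-LLY-edgeless H ¬e)) (1≤DN-LLY G)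
  cases (yes e) = ≡.subst₂ _≤⁺_ (≡.sym (DN-LLY-edge H e)) (≡.sym (DN-LLY-edge G (hasEdge-⊆ e)))
    (inf⁺-antimono (1# , λ r (𝓌 , _ , eq) → 1≤Dist H 𝓌 e eq)
      λ r (𝓌 , admissible , eq) → case Dist-restrict 𝓌 e eq of λ (s , eqᴴ , s≤r) →
        s , (restrict 𝓌 , admissible-restrict 𝓌 finite treeLike admissible , eqᴴ) , s≤r)
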